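{- Let $a,b,c\in\mathbb{Q}^\times$, let $n$ be a positive integer, and let $X$ be the projective plane curve defined by $ax^n+by^n+cz^n=0$. Let $K$ be a field of characteristic zero whose absolute Galois group $G_K$ is (topologically) finitely generated. If $X(K)\neq\emptyset$, then $X(K)$ is infinite.
   Context: For a field $K$ of characteristic zero, $G_K=\mathrm{Gal}(\bar K/K)$ is the absolute Galois group of $K$, regarded as a profinite group; "finitely generated" means that some finite subset generates a dense subgroup. $X(K)$ is the set of points $(x:y:z)\in\mathbb{P}^2(K)$ with $ax^n+by^n+cz^n=0$. -}

module Defs where

open import Level using (Level; _⊔_) renaming (suc to lsuc)
open import Algebra.Apartness.Bundles using (HeytingCommutativeRing; HeytingField)
open import Algebra.Bundles using (CommutativeRing; Group)
open import Algebra.Morphism.Structures using (module RingMorphisms)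
import Algebra.Morphism.Construct.Composition as Compose
import Algebra.Morphism.Construct.Identity as Identity
import Algebra.Properties.Ring as RingProperties
import Algebra.Properties.Semiring.Exp as Exp
import Algebra.Properties.Semiring.Mult as Mult
open import Data.Integer.Base as ℤ using (ℤ)
open import Data.List.Base using (List; _∷_; foldr; map)
import Data.List.Membership.Setoid as Membership
open import Data.List.Relation.Unary.All using (All)
open import Data.List.Relation.Unary.Any using (Any)
import Data.List.Relation.Unary.Enumerates.Setoid as Enumerates
open import Data.Nat.Base using (ℕ; suc)
open import Data.Product.Base using (Σ; ∃-syntax; _×_; _,_; proj₁; proj₂)
open import Data.Rational.Base using (ℚ; mkℚ)
open import Data.Sum.Base using (_⊎_)
open import Function.Base using (_∘_)
open import Relation.Binary.Bundles using (Setoid)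
import Relation.Binary.Construct.On as On
import Relation.Binary.Reasoning.Setoid as SetoidReasoning
open import Relation.Nullary.Negation using (¬_)

private
  variable
    a ℓ p : Level

Finite Infinite : Setoid a ℓ → Set (a ⊔ ℓ)
Finite   S = ∃[ xs ] Enumerates.IsEnumeration S xs
Infinite S = ¬ Finite S

module _ (G : Group a ℓ) where
  open Group G using (Carrier; _≈_; _∙_; ε; _⁻¹)

  data GeneratedSubgroup (S : Carrier → Set p) : Carrier → Set (a ⊔ ℓ ⊔ p) where
    generator : ∀ {g} → S g → GeneratedSubgroup S g
    identity  : GeneratedSubgroup S ε
    product   : ∀ {g h} → GeneratedSubgroup S g → GeneratedSubgroup S h →
                GeneratedSubgroup S (g ∙ h)
    inverse   : ∀ {g} → GeneratedSubgroup S g → GeneratedSubgroup S (g ⁻¹)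
    respects  : ∀ {g h} → g ≈ h → GeneratedSubgroup S g → GeneratedSubgroup S h

-- `HeytingField` does not re-export its underlying `CommutativeRing`.  In the
-- presence of excluded middle its apartness x # y is equivalent to ¬ x ≈ y,
-- and Heyting fields are exactly fields.
module FieldTheory {c ℓ₁ ℓ₂} (K : HeytingField c ℓ₁ ℓ₂) where

  open HeytingField K public using (_#_; #⇒invertible; invertible⇒#)

  commutativeRing : CommutativeRing c ℓ₁
  commutativeRing =
    HeytingCommutativeRing.commutativeRing (HeytingField.heytingCommutativeRing K)

  open CommutativeRing commutativeRing public hiding (zero)
  open Exp semiring public using (_^_)
  open Mult semiring public using () renaming (_×_ to _·_)
  open RingProperties ring using (-0#≈0#)

  private
    x-0≈x : ∀ x → x - 0# ≈ x
    x-0≈x x = trans (+-congˡ -0#≈0#) (+-identityʳ x)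

  #0⇒inverse : ∀ {x} → x # 0# → ∃[ y ] x * y ≈ 1#
  #0⇒inverse {x} x#0 with #⇒invertible x#0
  ... | y , _ , xy≈1 = y , trans (*-congʳ (sym (x-0≈x x))) xy≈1

  inverse⇒#0 : ∀ {x y} → x * y ≈ 1# → x # 0#
  inverse⇒#0 {x} {y} xy≈1 =
    invertible⇒# (y , trans (*-congˡ (x-0≈x x)) (trans (*-comm y x) xy≈1)
                    , trans (*-congʳ (x-0≈x x)) xy≈1)

  CharacteristicZero : Set ℓ₂
  CharacteristicZero = ∀ n → suc n · 1# # 0#

  fromℤ : ℤ → Carrier
  fromℤ (ℤ.+ n)    = n · 1#
  fromℤ ℤ.-[1+ n ] = - (suc n · 1#)

  fromℚ : CharacteristicZero → ℚ → Carrier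
  fromℚ char0 (mkℚ num den-1 _) =
    fromℤ num * proj₁ (#0⇒inverse (char0 den-1))

  -- Polynomials are lists of coefficients, constant term first.
  evaluate : List Carrier → Carrier → Carrier
  evaluate cs x = foldr (λ c v → c + x * v) 0# cs

  data NonConstant : List Carrier → Set (c ⊔ ℓ₂) where
    nonConstant : ∀ {c₀ cs} → Any (_# 0#) cs → NonConstant (c₀ ∷ cs)

  AlgebraicallyClosed : Set (c ⊔ ℓ₁ ⊔ ℓ₂)
  AlgebraicallyClosed = ∀ {f} → NonConstant f → ∃[ x ] evaluate f x ≈ 0#

record AlgebraicClosure {c ℓ₁ ℓ₂} (K : HeytingField c ℓ₁ ℓ₂) (c′ ℓ₁′ ℓ₂′ : Level)
       : Set (c ⊔ ℓ₁ ⊔ ℓ₂ ⊔ lsuc (c′ ⊔ ℓ₁′ ⊔ ℓ₂′)) where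
  private module K = FieldTheory K
  field
    heytingField : HeytingField c′ ℓ₁′ ℓ₂′
  open FieldTheory heytingField public
  field
    embed               : K.Carrier → Carrier
    isRingHomomorphism  : RingMorphisms.IsRingHomomorphism K.rawRing rawRing embed
    algebraic           : ∀ x → ∃[ f ] K.NonConstant f × evaluate (map embed f) x ≈ 0#
    algebraicallyClosed : AlgebraicallyClosed

module AbsoluteGalois {c ℓ₁ ℓ₂ c′ ℓ₁′ ℓ₂′} {K : HeytingField c ℓ₁ ℓ₂}
                      (K̄ : AlgebraicClosure K c′ ℓ₁′ ℓ₂′) where
  private module K = FieldTheory K
  open AlgebraicClosure K̄
  open RingMorphisms rawRing rawRing using (IsRingIsomorphism)

  record Automorphism : Set (c ⊔ c′ ⊔ ℓ₁′) where
    field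
      ⟦_⟧               : Carrier → Carrier
      isRingIsomorphism : IsRingIsomorphism ⟦_⟧
      fixes             : ∀ x → ⟦ embed x ⟧ ≈ embed x
    open IsRingIsomorphism isRingIsomorphism public

    ⟦_⟧⁻¹ : Carrier → Carrier
    ⟦ y ⟧⁻¹ = proj₁ (surjective y)

    inverseʳ : ∀ y → ⟦ ⟦ y ⟧⁻¹ ⟧ ≈ y
    inverseʳ y = proj₂ (surjective y) refl

    inverseˡ : ∀ x → ⟦ ⟦ x ⟧ ⟧⁻¹ ≈ x
    inverseˡ x = injective (inverseʳ ⟦ x ⟧)

  open Automorphism using (⟦_⟧)

  idᴬ : Automorphism
  idᴬ = record
    { ⟦_⟧               = λ x → x
    ; isRingIsomorphism = Identity.isRingIsomorphism rawRing refl
    ; fixes             = λ _ → refl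
    }

  _∘ᴬ_ : Automorphism → Automorphism → Automorphism
  σ ∘ᴬ τ = record
    { ⟦_⟧               = σ.⟦_⟧ ∘ τ.⟦_⟧
    ; isRingIsomorphism =
        Compose.isRingIsomorphism trans τ.isRingIsomorphism σ.isRingIsomorphism
    ; fixes             = λ x → trans (σ.⟦⟧-cong (τ.fixes x)) (σ.fixes x)
    }
    where module σ = Automorphism σ
          module τ = Automorphism τ

  _⁻¹ᴬ : Automorphism → Automorphism
  σ ⁻¹ᴬ = record
    { ⟦_⟧               = ⟦_⟧⁻¹
    ; isRingIsomorphism = record
      { isRingMonomorphism = record
        { isRingHomomorphism = record
          { isSemiringHomomorphism = record
            { isNearSemiringHomomorphism = record
              { +-isMonoidHomomorphism = record
                { isMagmaHomomorphism = record
                  { isRelHomomorphism = record { cong = ⁻¹-cong }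
                  ; homo = λ x y → injective (trans (inverseʳ (x + y))
                      (sym (trans (+-homo _ _) (+-cong (inverseʳ x) (inverseʳ y)))))
                  }
                ; ε-homo = injective (trans (inverseʳ 0#) (sym 0#-homo))
                }
              ; *-homo = λ x y → injective (trans (inverseʳ (x * y))
                  (sym (trans (*-homo _ _) (*-cong (inverseʳ x) (inverseʳ y)))))
              }
            ; 1#-homo = injective (trans (inverseʳ 1#) (sym 1#-homo))
            }
          ; -‿homo = λ x → injective (trans (inverseʳ (- x))
              (sym (trans (-‿homo _) (-‿cong (inverseʳ x)))))
          }
        ; injective = λ {x} {y} eq →
            trans (sym (inverseʳ x)) (trans (⟦⟧-cong eq) (inverseʳ y))
        }
      ; surjective = λ x → σ.⟦ x ⟧ , λ z≈σx → trans (⁻¹-cong z≈σx) (inverseˡ x)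
      }
    ; fixes = λ x → injective (trans (inverseʳ (embed x)) (sym (fixes x)))
    }
    where
    module σ = Automorphism σ
    open σ hiding (⟦_⟧)
    ⁻¹-cong : ∀ {x y} → x ≈ y → ⟦ x ⟧⁻¹ ≈ ⟦ y ⟧⁻¹
    ⁻¹-cong {x} {y} x≈y =
      injective (trans (inverseʳ x) (trans x≈y (sym (inverseʳ y))))

  galoisGroup : Group (c ⊔ c′ ⊔ ℓ₁′) (c′ ⊔ ℓ₁′)
  galoisGroup = record
    { Carrier = Automorphism
    ; _≈_     = λ σ τ → ∀ x → ⟦ σ ⟧ x ≈ ⟦ τ ⟧ x
    ; _∙_     = _∘ᴬ_
    ; ε       = idᴬ
    ; _⁻¹     = _⁻¹ᴬ
    ; isGroup = record
      { isMonoid = record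
        { isSemigroup = record
          { isMagma = record
            { isEquivalence = record
              { refl  = λ _ → refl
              ; sym   = λ σ≈τ x → sym (σ≈τ x)
              ; trans = λ ρ≈σ σ≈τ x → trans (ρ≈σ x) (σ≈τ x)
              }
            ; ∙-cong = λ {σ} {σ′} {τ} {τ′} σ≈σ′ τ≈τ′ x →
                trans (Automorphism.⟦⟧-cong σ (τ≈τ′ x)) (σ≈σ′ (⟦ τ′ ⟧ x))
            }
          ; assoc = λ _ _ _ _ → refl
          }
        ; identity = (λ _ _ → refl) , (λ _ _ → refl)
        }
      ; inverse = Automorphism.inverseˡ , Automorphism.inverseʳ
      ; ⁻¹-cong = λ {σ} {τ} σ≈τ x → Automorphism.injective σ
          (trans (Automorphism.inverseʳ σ x)
            (sym (trans (σ≈τ _) (Automorphism.inverseʳ τ x))))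
      }
    }

  open Group galoisGroup using () renaming (setoid to automorphismSetoid)
  open Membership automorphismSetoid using (_∈_)

  -- The automorphisms agreeing with σ on xs form the coset σ·Gal(K̄/K(xs)).
  -- Every finite extension of K inside K̄ is of the form K(xs), so these are the
  -- basic open neighbourhoods of σ in the Krull (profinite) topology.
  AgreeOn : List Carrier → Automorphism → Automorphism → Set (c′ ⊔ ℓ₁′)
  AgreeOn xs σ τ = All (λ x → ⟦ τ ⟧ x ≈ ⟦ σ ⟧ x) xs

  Dense : (Automorphism → Set p) → Set (c ⊔ c′ ⊔ ℓ₁′ ⊔ p)
  Dense P = ∀ σ xs → ∃[ τ ] P τ × AgreeOn xs σ τ

  TopologicallyFinitelyGenerated : Set (c ⊔ c′ ⊔ ℓ₁′)
  TopologicallyFinitelyGenerated =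
    ∃[ generators ] Dense (GeneratedSubgroup galoisGroup (_∈ generators))

module ProjectivePlane {k ℓ₁ ℓ₂} (K : HeytingField k ℓ₁ ℓ₂) where
  open FieldTheory K

  record HomogeneousCoordinates : Set (k ⊔ ℓ₂) where
    constructor [_∶_∶_]⟨_⟩
    field
      x y z   : Carrier
      nonZero : x # 0# ⊎ y # 0# ⊎ z # 0#

  open HomogeneousCoordinates

  _∼_ : HomogeneousCoordinates → HomogeneousCoordinates → Set (k ⊔ ℓ₁ ⊔ ℓ₂)
  P ∼ Q = ∃[ u ] u # 0# × x Q ≈ u * x P × y Q ≈ u * y P × z Q ≈ u * z P

  ℙ² : Setoid (k ⊔ ℓ₂) (k ⊔ ℓ₁ ⊔ ℓ₂)
  ℙ² = record
    { Carrier       = HomogeneousCoordinates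
    ; _≈_           = _∼_
    ; isEquivalence = record
        { refl  = λ {P} → ∼-refl {P}
        ; sym   = λ {P} {Q} → ∼-sym {P} {Q}
        ; trans = λ {P} {Q} {R} → ∼-trans {P} {Q} {R}
        }
    }
    where
    ∼-refl : ∀ {P} → P ∼ P
    ∼-refl = 1# , inverse⇒#0 (*-identityˡ 1#)
           , sym (*-identityˡ _) , sym (*-identityˡ _) , sym (*-identityˡ _)

    ∼-sym : ∀ {P Q} → P ∼ Q → Q ∼ P
    ∼-sym (u , u#0 , ex , ey , ez) with #0⇒inverse u#0
    ... | v , uv≈1 = v , inverse⇒#0 vu≈1 , back ex , back ey , back ez
      where
      vu≈1 : v * u ≈ 1#
      vu≈1 = trans (*-comm v u) uv≈1
      back : ∀ {s t} → t ≈ u * s → s ≈ v * t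
      back t≈us = sym (trans (*-congˡ t≈us)
        (trans (sym (*-assoc v u _)) (trans (*-congʳ vu≈1) (*-identityˡ _))))

    ∼-trans : ∀ {P Q R} → P ∼ Q → Q ∼ R → P ∼ R
    ∼-trans (u , u#0 , ex , ey , ez) (v , v#0 , fx , fy , fz)
      with #0⇒inverse u#0 | #0⇒inverse v#0
    ... | u′ , uu′≈1 | v′ , vv′≈1 =
      v * u , inverse⇒#0 vu-inverse , both ex fx , both ey fy , both ez fz
      where
      both : ∀ {r s t} → s ≈ u * r → t ≈ v * s → t ≈ (v * u) * r
      both s≈ur t≈vs = trans t≈vs (trans (*-congˡ s≈ur) (sym (*-assoc v u _)))
      open SetoidReasoning setoid
      vu-inverse : (v * u) * (u′ * v′) ≈ 1#
      vu-inverse = begin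
        (v * u) * (u′ * v′) ≈⟨ *-assoc v u (u′ * v′) ⟩
        v * (u * (u′ * v′)) ≈⟨ *-congˡ (sym (*-assoc u u′ v′)) ⟩
        v * ((u * u′) * v′) ≈⟨ *-congˡ (*-congʳ uu′≈1) ⟩
        v * (1# * v′)       ≈⟨ *-congˡ (*-identityˡ v′) ⟩
        v * v′              ≈⟨ vv′≈1 ⟩
        1#                  ∎

  module _ (char0 : CharacteristicZero) (a b c : ℚ) (n : ℕ) where
    private
      ι : ℚ → Carrier
      ι = fromℚ char0

    OnFermatCurve : HomogeneousCoordinates → Set ℓ₁
    OnFermatCurve P = ι a * x P ^ n + ι b * y P ^ n + ι c * z P ^ n ≈ 0#

    fermatCurvePoints : Setoid (k ⊔ ℓ₁ ⊔ ℓ₂) (k ⊔ ℓ₁ ⊔ ℓ₂)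
    fermatCurvePoints = On.setoid {B = Σ HomogeneousCoordinates OnFermatCurve} ℙ² proj₁

{-# OPTIONS --safe #-}

-- K*/(K*)ⁿ is finite: the Kummer cocycle σ ↦ σ(α)/α of an n-th root α of x takes
-- values in the finite set μₙ, and its values on topological generators determine
-- x modulo n-th powers, since an element of K̄ fixed by all automorphisms lies in K (by
-- Zorn's lemma every K-embedding of a subfield extends to K̄).  Colour K by these finitely many classes.  If
-- A = axⁿ, B = byⁿ, C = czⁿ come from a point with non-zero coordinates, Gallai's
-- theorem gives u and t ≠ 0 such that u and all u + t(kB), u − t(kA), 1 ≤ k ≤ N, have
-- the same colour, i.e. are u, uβₖⁿ, uγₖⁿ; as A + B + C = 0, the points
-- (xβₖ : yγₖ : z) lie on the curve, and they are distinct.  If one coordinate of the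
-- point vanishes, a similar use of Gallai's theorem first makes all coordinates non-zero.
module Submission where

open import Defs
open import Algebra.Apartness.Bundles using (HeytingField)
open import Algebra.Bundles using (CommutativeMonoid; CommutativeRing; Group; RawRing)
open import Algebra.Morphism.Structures using (module RingMorphisms)
import Algebra.Properties.AbelianGroup as AbelianGroupProperties
import Algebra.Properties.CommutativeMonoid.Mult as CommutativeMonoidMult
import Algebra.Properties.CommutativeSemigroup as CommutativeSemigroupProperties
import Algebra.Properties.CommutativeSemiring.Exp as CommutativeSemiringExp
import Algebra.Properties.Ring as RingProperties
import Algebra.Properties.Semiring.Mult as SemiringMult
import Algebra.Properties.Semiring.Mult.TCOptimised as OptimisedMult
import Algebra.Solver.Ring
open import Algebra.Solver.Ring.AlmostCommutativeRing using (fromCommutativeRing; _-Raw-AlmostCommutative⟶_)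
open import Axiom.ExcludedMiddle using (ExcludedMiddle)
open import Axiom.Extensionality.Propositional using (Extensionality)
open import Data.Bool.Base using (Bool; true; false; T)
open import Data.Empty using (⊥; ⊥-elim)
open import Data.Fin.Base using (Fin; zero; suc; combine; finToFun; funToFin; toℕ)
import Data.Fin.Properties as Finₚ
open import Data.Integer.Base as ℤ using (ℤ; 0ℤ; 1ℤ)
import Data.Integer.Properties as ℤₚ
open import Data.List.Base as List
  using (List; []; _∷_; _++_; cartesianProductWith; concatMap; length; lookup; tabulate)
open import Data.List.Membership.Propositional using (_∈_)
open import Data.List.Membership.Propositional.Properties
  using (∈-map⁺; ∈-++⁺ˡ; ∈-++⁺ʳ; ∈-cartesianProductWith⁺; ∈-concatMap⁺)
import Data.List.Membership.Setoid as Membership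
open import Data.List.Relation.Unary.All as All using (All; []; _∷_)
import Data.List.Relation.Unary.All.Properties as Allₚ
open import Data.List.Relation.Unary.Any as Any using (Any; here; there)
import Data.List.Relation.Unary.Any.Properties as Anyₚ
import Data.Maybe.Base as Maybe
open import Data.Nat.Base as ℕ using (ℕ; zero; suc; _<_; z≤n; s≤s; NonZero)
open import Data.Nat.Induction using (<-rec)
import Data.Nat.Properties as ℕₚ
open import Data.Product.Base using (Σ; ∃-syntax; _×_; _,_; proj₁; proj₂; swap)
open import Data.Rational.Base using (ℚ; mkℚ; 0ℚ)
import Data.Rational.Properties as ℚₚ
open import Data.Sum.Base using (_⊎_; inj₁; inj₂; [_,_]′)
open import Data.Unit.Base using (tt)
open import Data.Vec.Base as Vec using (Vec; []; _∷_; _∷ʳ_; initLast; toList)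
open import Data.Vec.Properties using (length-toList)
open import Function.Base using (_∘_; id)
open import Level using (_⊔_) renaming (suc to lsuc)
open import Relation.Binary.Bundles using (Setoid)
open import Relation.Binary.PropositionalEquality as ≡ using (_≡_; _≢_; cong)
import Relation.Binary.Reasoning.Setoid as SetoidReasoning
open import Relation.Nullary.Decidable using (Dec; yes; no; ⌊_⌋; dec⇒maybe; fromWitness; toWitness)
open import Relation.Nullary.Negation using (¬_)

-- Power classes are multiplicative while the equation is additive; a colouring bridges the two,
-- because Gallai's theorem asks nothing of a colouring but finiteness. That u + tw has the class of
-- u means that it is u times an n-th power. Moreover u is non-zero, since 0 is alone in its class.
-- Hence the identity A(u + tkB) + B(u - tkA) + Cu = u(A + B + C) can be divided by u; the vectors
-- kB and -kA are chosen to make its t-terms cancel. A vanishing coordinate is filled by solving hⁿ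
-- = 1 + rgⁿ with g and h non-zero. Here the step t matters as well as u, and nothing is known about
-- the class of u/t; putting r times a representative of every class among the vectors covers all
-- possibilities at once. Characteristic zero enters three times: to divide by the degree of a
-- minimal polynomial with a single root, to keep the dilation factor of Gallai's theorem, a
-- positive integer, non-zero in K, and to keep the multiples k distinct.

-- A ring solver with integer coefficients

module IntegerSolver {c ℓ} (R : CommutativeRing c ℓ) where
  open CommutativeRing R
  open RingProperties ring
  open AbelianGroupProperties +-abelianGroup using (⁻¹-∙-comm)
  open OptimisedMult semiring using (×-homo-+; ×1-homo-*) renaming (_×_ to _×ₙ_)
  open SetoidReasoning setoid

  private
    open import Data.Integer.Base using (+_; -[1+_])

    -- The optimised multiple reduces `nat 0` to `0#` and `nat 1` to `1#`, so `con 0ℤ` and `con 1ℤ`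
    -- denote these constants definitionally in the calls of `solve`.
    nat : ℕ → Carrier
    nat n = n ×ₙ 1#

    int : ℤ → Carrier
    int (+ n)    = nat n
    int -[1+ n ] = - nat (suc n)

    nat-suc : ∀ n → nat (suc n) ≈ 1# + nat n
    nat-suc = ×-homo-+ 1# 1

    int-⊖ : ∀ m n → int (m ℤ.⊖ n) ≈ nat m - nat n
    int-⊖ zero    zero    = sym (-‿inverseʳ 0#)
    int-⊖ zero    (suc n) = sym (+-identityˡ _)
    int-⊖ (suc m) zero    = sym (trans (+-congˡ -0#≈0#) (+-identityʳ _))
    int-⊖ (suc m) (suc n) = begin
      int (suc m ℤ.⊖ suc n)               ≡⟨ ≡.cong int (ℤₚ.[1+m]⊖[1+n]≡m⊖n m n) ⟩
      int (m ℤ.⊖ n)                       ≈⟨ int-⊖ m n ⟩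
      nat m - nat n                       ≈⟨ +-congʳ (+-identityˡ _) ⟨
      (0# + nat m) - nat n                ≈⟨ +-congʳ (+-congʳ (-‿inverseˡ 1#)) ⟨
      ((- 1# + 1#) + nat m) - nat n       ≈⟨ +-congʳ (+-assoc _ _ _) ⟩
      (- 1# + (1# + nat m)) - nat n       ≈⟨ +-congʳ (+-comm _ _) ⟩
      ((1# + nat m) + - 1#) - nat n       ≈⟨ +-assoc _ _ _ ⟩
      (1# + nat m) + (- 1# + - nat n)     ≈⟨ +-congˡ (⁻¹-∙-comm _ _) ⟩
      (1# + nat m) - (1# + nat n)         ≈⟨ +-cong (nat-suc m) (-‿cong (nat-suc n)) ⟨
      nat (suc m) - nat (suc n)           ∎

    int-+ : ∀ i j → int (i ℤ.+ j) ≈ int i + int j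
    int-+ (+ m)    (+ n)    = ×-homo-+ 1# m n
    int-+ (+ m)    -[1+ n ] = int-⊖ m (suc n)
    int-+ -[1+ m ] (+ n)    = trans (int-⊖ n (suc m)) (+-comm _ _)
    int-+ -[1+ m ] -[1+ n ] = begin
      - nat (suc (suc (m ℕ.+ n)))   ≡⟨ ≡.cong (λ k → - nat (suc k)) (≡.sym (ℕₚ.+-suc m n)) ⟩
      - nat (suc m ℕ.+ suc n)       ≈⟨ -‿cong (×-homo-+ 1# (suc m) (suc n)) ⟩
      - (nat (suc m) + nat (suc n)) ≈⟨ ⁻¹-∙-comm _ _ ⟨
      - nat (suc m) - nat (suc n)   ∎

    int-neg : ∀ i → int (ℤ.- i) ≈ - int i
    int-neg (+ zero)  = sym -0#≈0#
    int-neg (+ suc n) = refl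
    int-neg -[1+ n ]  = sym (-‿involutive _)

    int-*-pos : ∀ m j → int (+ m ℤ.* j) ≈ nat m * int j
    int-*-pos m (+ n) = trans (reflexive (≡.cong int (≡.sym (ℤₚ.pos-* m n)))) (×1-homo-* m n)
    int-*-pos m -[1+ n ] = begin
      int (+ m ℤ.* -[1+ n ])       ≡⟨ ≡.cong int (≡.sym (ℤₚ.neg-distribʳ-* (+ m) (+ suc n))) ⟩
      int (ℤ.- (+ m ℤ.* + suc n))  ≈⟨ int-neg (+ m ℤ.* + suc n) ⟩
      - int (+ m ℤ.* + suc n)      ≈⟨ -‿cong (int-*-pos m (+ suc n)) ⟩
      - (nat m * nat (suc n))      ≈⟨ -‿distribʳ-* _ _ ⟩
      nat m * - nat (suc n)        ∎

    int-* : ∀ i j → int (i ℤ.* j) ≈ int i * int j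
    int-* (+ m)    j = int-*-pos m j
    int-* -[1+ m ] j = begin
      int (-[1+ m ] ℤ.* j)         ≡⟨ ≡.cong int (≡.sym (ℤₚ.neg-distribˡ-* (+ suc m) j)) ⟩
      int (ℤ.- (+ suc m ℤ.* j))    ≈⟨ int-neg (+ suc m ℤ.* j) ⟩
      - int (+ suc m ℤ.* j)        ≈⟨ -‿cong (int-*-pos (suc m) j) ⟩
      - (nat (suc m) * int j)      ≈⟨ -‿distribˡ-* _ _ ⟩
      - nat (suc m) * int j        ∎

    homomorphism : ℤ.+-*-rawRing -Raw-AlmostCommutative⟶ fromCommutativeRing R
    homomorphism = record
      { ⟦_⟧ = int ; +-homo = int-+ ; *-homo = int-* ; -‿homo = int-neg
      ; 0-homo = refl ; 1-homo = refl }

  open Algebra.Solver.Ring ℤ.+-*-rawRing (fromCommutativeRing R) homomorphism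
    (λ i j → Maybe.map (λ i≡j → reflexive (≡.cong int i≡j)) (dec⇒maybe (i ℤₚ.≟ j)))
    public using (solve; _:=_; con; _:+_; _:*_; _:-_; :-_)

-- Gallai's theorem

funToFin-cong : ∀ {m n} {f g : Fin m → Fin n} → (∀ i → f i ≡ g i) → funToFin f ≡ funToFin g
funToFin-cong {zero}  f≗g = ≡.refl
funToFin-cong {suc m} f≗g = ≡.cong₂ combine (f≗g zero) (funToFin-cong (f≗g ∘ suc))

funToFin-injective : ∀ {m n} {f g : Fin m → Fin n} → funToFin f ≡ funToFin g → ∀ i → f i ≡ g i
funToFin-injective {f = f} {g} eq i = ≡.trans (≡.sym (Finₚ.finToFun-funToFin f i))
  (≡.trans (cong (λ k → finToFun k i) eq) (Finₚ.finToFun-funToFin g i))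

module Gallai {c ℓ} (M : CommutativeMonoid c ℓ) where
  open CommutativeMonoid M renaming
    (_∙_ to _+_; ε to 0#; ∙-congʳ to +-congʳ; ∙-congˡ to +-congˡ; comm to +-comm; assoc to +-assoc)
  open CommutativeMonoidMult M using (×-homo-+) renaming (_×_ to _·_)
  open CommutativeSemigroupProperties commutativeSemigroup using (interchange)

  Colouring : ℕ → Set (c ⊔ ℓ)
  Colouring r = Σ (Carrier → Fin r) λ χ → ∀ {x y} → x ≈ y → χ x ≡ χ y

  -- A combinatorial line of the Hales-Jewett theorem with its word forgotten: `u` adds up the fixed
  -- letters and `t` counts the places of the variable.
  Line : Set c
  Line = Carrier × ℕ

  at : Line → Carrier → Carrier
  at (u , t) v = u + t · v

  _⊕_ : Line → Line → Line
  (u , s) ⊕ (v , t) = u + v , s ℕ.+ t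

  shift : Carrier → Line → Line
  shift x (u , t) = x + u , t

  at-⊕ : ∀ l m v → at (l ⊕ m) v ≈ at l v + at m v
  at-⊕ (u , s) (v , t) w = trans (+-congˡ (×-homo-+ w s t)) (interchange u v (s · w) (t · w))

  at-shift : ∀ x l v → at (shift x l) v ≈ x + at l v
  at-shift x (u , t) v = +-assoc x u (t · v)

  Monochromatic : ∀ {r} → (Carrier → Fin r) → List Carrier → Line → Set c
  Monochromatic χ V l = 0 < proj₂ l × ∃[ k ] All (λ v → χ (at l v) ≡ k) V

  -- The finite list of lines is chosen before the colouring: this uniformity
  -- is what lets the induction pass to product colourings.
  Unavoidable : List Carrier → Set (c ⊔ ℓ)
  Unavoidable V = ∀ r → ∃[ L ] (∀ ((χ , _) : Colouring r) → ∃[ l ] l ∈ L × Monochromatic χ V l)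

  -- Stores the whole pattern of `χ` on the translate of `W` by `x`, so that a line monochromatic
  -- for it moves `W` around without changing any colour.
  productColouring : ∀ {r} → Colouring r → (W : List Carrier) → Colouring (r ℕ.^ length W)
  productColouring (χ , χ-cong) W =
    (λ x → funToFin (λ i → χ (x + lookup W i))) ,
    (λ x≈y → funToFin-cong {length W} (λ i → χ-cong (+-congʳ x≈y)))

  productColouring-≡ : ∀ {r} ((χ , χ-cong) : Colouring r) W {x y} →
    let χ′ = proj₁ (productColouring (χ , χ-cong) W) in
    χ′ x ≡ χ′ y → ∀ {w} → w ∈ W → χ (x + w) ≡ χ (y + w)
  productColouring-≡ (χ , _) W {x} {y} eq {w} w∈W =
    ≡.subst (λ w → χ (x + w) ≡ χ (y + w)) (≡.sym (Anyₚ.lookup-index w∈W)) (funToFin-injective {length W} eq (Any.index w∈W))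

  -- The device of colour focusing: if the focus has the colour of one of the lines, that line stays
  -- monochromatic when `w` is added; otherwise the focus supplies one more colour.
  record Focused {r} (χ : Carrier → Fin r) (L : List Line) (V : List Carrier) (w f : Carrier) (s : ℕ)
         : Set (c ⊔ ℓ) where
    field
      lines     : Fin s → Line
      colours   : Fin s → Fin r
      injective : ∀ i j → colours i ≡ colours j → i ≡ j
      line∈L    : ∀ i → lines i ∈ L
      positive  : ∀ i → 0 < proj₂ (lines i)
      coloured  : ∀ i → All (λ v → χ (at (lines i) v) ≡ colours i) V
      focus     : ∀ i → at (lines i) w ≈ f

  module ColourFocusing (w v₀ : Carrier) (vs : List Carrier) (unavoidable : Unavoidable (v₀ ∷ vs)) (r : ℕ) where

    V = v₀ ∷ vs

    Outcome : ℕ → List Line → List Carrier → Set (c ⊔ ℓ)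
    Outcome s L P = ∀ ((χ , _) : Colouring r) →
      (∃[ l ] l ∈ L × Monochromatic χ (w ∷ V) l) ⊎ (∃[ f ] f ∈ P × Focused χ L V w f s)

    module Step (s : ℕ) (L : List Line) (P : List Carrier) (outcome : Outcome s L P) where

      -- All points whose colour must survive translation along the new line: the possible foci, and
      -- the values on `V` of the lines in `L`.
      W : List Carrier
      W = P ++ concatMap (λ l → List.map (at l) V) L

      L′ : List Line
      L′ = proj₁ (unavoidable (r ℕ.^ length W))

      sums constants translates : List Line
      sums       = cartesianProductWith _⊕_ L′ L
      constants  = cartesianProductWith (λ l p → shift p l) L′ P
      translates = cartesianProductWith (λ l m → shift (at l v₀) m) L′ L

      newLines : List Line
      newLines = sums ++ constants ++ translates

      newPoints : List Carrier
      newPoints = cartesianProductWith (λ l p → at l w + p) L′ P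

      ∈-sums : ∀ {l m} → l ∈ L′ → m ∈ L → (l ⊕ m) ∈ newLines
      ∈-sums l∈ m∈ = ∈-++⁺ˡ (∈-cartesianProductWith⁺ _⊕_ l∈ m∈)

      ∈-constants : ∀ {l p} → l ∈ L′ → p ∈ P → shift p l ∈ newLines
      ∈-constants l∈ p∈ = ∈-++⁺ʳ sums (∈-++⁺ˡ (∈-cartesianProductWith⁺ (λ l p → shift p l) l∈ p∈))

      ∈-translates : ∀ {l m} → l ∈ L′ → m ∈ L → shift (at l v₀) m ∈ newLines
      ∈-translates l∈ m∈ = ∈-++⁺ʳ sums (∈-++⁺ʳ constants (∈-cartesianProductWith⁺ (λ l m → shift (at l v₀) m) l∈ m∈))

      -- Since `l′` is monochromatic for the product colouring, `W` looks the same from every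
      -- `at l′ v`, so `outcome` can be applied to the single translate `χ₀`. The old lines are
      -- carried along by `l′`, and the additional line is `l′` shifted to the old focus; at `w`
      -- they all reach `at l′ w + f`.
      newOutcome : Outcome (suc s) newLines newPoints
      newOutcome χχ@(χ , χ-cong) with proj₂ (unavoidable (r ℕ.^ length W)) (productColouring χχ W)
      ... | l′ , l′∈ , l′-positive , _ , l′-mono@(v₀-mono ∷ _) = result
        where
        x₀ = at l′ v₀

        χ₀ : Carrier → Fin r
        χ₀ y = χ (x₀ + y)

        same : ∀ {v} → v ∈ V → ∀ {y} → y ∈ W → χ (at l′ v + y) ≡ χ₀ y
        same v∈V = productColouring-≡ χχ W (≡.trans (All.lookup l′-mono v∈V) (≡.sym v₀-mono))

        translated : ∀ {l k} → All (λ v → χ₀ (at l v) ≡ k) V → All (λ v → χ (at (shift x₀ l) v) ≡ k) V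
        translated {l} = All.map (λ {v} eq → ≡.trans (χ-cong (at-shift x₀ l v)) eq)

        result : _
        result with outcome (χ₀ , λ x≈y → χ-cong (+-congˡ x≈y))
        ... | inj₁ (l , l∈ , positive , k , eq ∷ mono) =
          inj₁ (shift x₀ l , ∈-translates l′∈ l∈ , positive , k , ≡.trans (χ-cong (at-shift x₀ l w)) eq ∷ translated {l} mono)
        ... | inj₂ (f , f∈ , focused) with Finₚ.any? (λ j → χ₀ f Finₚ.≟ Focused.colours focused j)
        ...   | yes (j , eq) = inj₁
          ( shift x₀ (lines j) , ∈-translates l′∈ (line∈L j) , positive j , colours j
          , ≡.trans (χ-cong (trans (at-shift x₀ (lines j) w) (+-congˡ (focus j)))) eq ∷ translated {lines j} (coloured j) )
          where open Focused focused
        ...   | no χf-new = inj₂ (at l′ w + f , ∈-cartesianProductWith⁺ (λ l p → at l w + p) l′∈ f∈ , record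
          { lines     = λ { zero → shift f l′ ; (suc j) → l′ ⊕ lines j }
          ; colours   = λ { zero → χ₀ f ; (suc j) → colours j }
          ; injective = λ { zero    zero    _  → ≡.refl
                          ; zero    (suc j) eq → ⊥-elim (χf-new (j , eq))
                          ; (suc i) zero    eq → ⊥-elim (χf-new (i , ≡.sym eq))
                          ; (suc i) (suc j) eq → cong suc (injective i j eq) }
          ; line∈L    = λ { zero → ∈-constants l′∈ f∈ ; (suc j) → ∈-sums l′∈ (line∈L j) }
          ; positive  = λ { zero → l′-positive ; (suc j) → ℕₚ.<-≤-trans l′-positive (ℕₚ.m≤m+n _ _) }
          ; coloured  = λ { zero → All.tabulate λ {v} v∈V → ≡.trans
                              (χ-cong (trans (at-shift f l′ v) (+-comm f _))) (same v∈V (∈-++⁺ˡ f∈))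
                          ; (suc j) → All.tabulate λ {v} v∈V → ≡.trans
                              (χ-cong (at-⊕ l′ (lines j) v))
                              (≡.trans (same v∈V (∈-++⁺ʳ P (∈-concatMap⁺ (λ l → List.map (at l) V)
                                         (Any.map (λ { ≡.refl → ∈-map⁺ (at (lines j)) v∈V }) (line∈L j)))))
                                       (All.lookup (coloured j) v∈V)) }
          ; focus     = λ { zero → trans (at-shift f l′ w) (+-comm f _)
                          ; (suc j) → trans (at-⊕ l′ (lines j) w) (+-congˡ (focus j)) }
          })
          where open Focused focused

    focusing : ∀ s → ∃[ L ] ∃[ P ] Outcome s L P
    focusing zero = [] , 0# ∷ [] , λ χ → inj₂ (0# , here ≡.refl , record
      { lines = λ () ; colours = λ () ; injective = λ () ; line∈L = λ () ; positive = λ () ; coloured = λ () ; focus = λ () })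
    focusing (suc s) with focusing s
    ... | L , P , outcome = newLines , newPoints , newOutcome
      where open Step s L P outcome

    extend : ∃[ L ] (∀ ((χ , _) : Colouring r) → ∃[ l ] l ∈ L × Monochromatic χ (w ∷ V) l)
    -- One line more than there are colours: the focused alternative then contradicts the pigeonhole
    -- principle.
    extend with focusing (suc r)
    ... | L , P , outcome = L , λ χ → [ (λ found → found) , (λ (_ , _ , focused) → ⊥-elim (tooMany focused)) ]′ (outcome χ)
      where
      tooMany : ∀ {χ f} → Focused χ L V w f (suc r) → ⊥
      tooMany focused with Finₚ.pigeonhole (ℕₚ.n<1+n r) (Focused.colours focused)
      ... | i , j , i<j , eq = Finₚ.<⇒≢ i<j (Focused.injective focused i j eq)

  unavoidable : ∀ v vs → Unavoidable (v ∷ vs)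
  unavoidable v []       r = (0# , 1) ∷ [] , λ (χ , _) → (0# , 1) , here ≡.refl , s≤s z≤n , _ , ≡.refl ∷ []
  unavoidable w (v ∷ vs) r = ColourFocusing.extend w v vs (unavoidable v vs) r

  gallai : ∀ v vs {r} ((χ , _) : Colouring r) → ∃[ l ] Monochromatic χ (v ∷ vs) l
  gallai v vs {r} χ with proj₂ (unavoidable v vs r) χ
  ... | l , _ , mono = l , mono

-- Zorn's lemma

-- Subsets are Boolean-valued so that, with excluded middle, they are closed
-- under impredicative constructions without any rise in universe level.
Subset : ∀ {a} → Set a → Set a
Subset A = A → Bool

infix 4 _∈ₛ_ _⊆_
_∈ₛ_ : ∀ {a} {A : Set a} → A → Subset A → Set
x ∈ₛ S = T (S x)

_⊆_ : ∀ {a} {A : Set a} → Subset A → Subset A → Set a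
S ⊆ S′ = ∀ {x} → x ∈ₛ S → x ∈ₛ S′

module Zorn (em : ∀ {ℓ} → ExcludedMiddle ℓ) (ext : ∀ {ℓ ℓ′} → Extensionality ℓ ℓ′)
            {a p} {A : Set a} (P : Subset A → Set p) where

  ⋃ : Subset (Subset A) → Subset A
  ⋃ C x = ⌊ em {P = ∃[ S ] S ∈ₛ C × x ∈ₛ S} ⌋

  ⊆-⋃ : ∀ {C S} → S ∈ₛ C → S ⊆ ⋃ C
  ⊆-⋃ S∈C x∈S = fromWitness (_ , S∈C , x∈S)

  ∈-⋃⁻ : ∀ {C x} → x ∈ₛ ⋃ C → ∃[ S ] S ∈ₛ C × x ∈ₛ S
  ∈-⋃⁻ = toWitness

  ⊆-antisym : ∀ {S S′ : Subset A} → S ⊆ S′ → S′ ⊆ S → S ≡ S′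
  ⊆-antisym {S} {S′} S⊆S′ S′⊆S = ext (λ x → same (S x) (S′ x) (S⊆S′ {x}) (S′⊆S {x}))
    where
    same : ∀ b c → (T b → T c) → (T c → T b) → b ≡ c
    same true  true  _ _ = ≡.refl
    same true  false f _ = ⊥-elim (f tt)
    same false true  _ g = ⊥-elim (g tt)
    same false false _ _ = ≡.refl

  Maximal : Subset A → Set (a ⊔ p)
  Maximal S = ∀ {N} → P N → S ⊆ N → N ⊆ S

  -- Here `em` serves as the choice function: it names one strict enlargement satisfying `P`
  -- whenever there is one. Otherwise `S` is its own successor, so a set that contains its successor
  -- is maximal.
  successor : ∀ S → ∃[ N ] S ⊆ N × (P S → P N) × (N ⊆ S → Maximal S)
  successor S with em {P = ∃[ N ] P N × S ⊆ N × ¬ N ⊆ S}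
  ... | yes (N , PN , S⊆N , N⊈S) = N , S⊆N , (λ _ → PN) , (λ N⊆S → ⊥-elim (N⊈S N⊆S))
  ... | no  none = S , id , id , maximal
    where
    maximal : S ⊆ S → Maximal S
    maximal _ {N} PN S⊆N with em {P = N ⊆ S}
    ... | yes N⊆S = N⊆S
    ... | no  N⊈S = ⊥-elim (none (N , PN , S⊆N , N⊈S))

  next : Subset A → Subset A
  next S = proj₁ (successor S)

  ⊆-next : ∀ {S} → S ⊆ next S
  ⊆-next {S} {x} = proj₁ (proj₂ (successor S)) {x}

  module _ (B : Subset A) where

    -- The least family containing `B` and closed under successors and non-empty unions replaces
    -- transfinite iteration. `limit` accepts any family of towers; that they are comparable is
    -- proved afterwards.
    data Tower : Subset A → Set a where
      base  : Tower B
      step  : ∀ {S} → Tower S → Tower (next S)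
      limit : ∀ C → ∃[ S ] S ∈ₛ C → (∀ {S} → S ∈ₛ C → Tower S) → Tower (⋃ C)

    base⊆ : ∀ {S} → Tower S → B ⊆ S
    base⊆ base                          x∈ = x∈
    base⊆ (step tS)                     x∈ = ⊆-next (base⊆ tS x∈)
    base⊆ (limit C (S , S∈C) tC) {x} x∈ = ⊆-⋃ {C} S∈C {x} (base⊆ (tC S∈C) x∈)

    -- The condition on `Y` makes it an extreme point in the sense of the Bourbaki-Witt argument: by
    -- induction on `X`, the tower cannot leave `Y` without swallowing its successor.
    compare : ∀ {X Y} → Tower X → Tower Y → (∀ {Z} → Tower Z → Z ⊆ Y → Z ≡ Y ⊎ next Z ⊆ Y) →
              X ⊆ Y ⊎ next Y ⊆ X
    compare base tY cond = inj₁ (base⊆ tY)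
    compare (step tX) tY cond with compare tX tY cond
    ... | inj₂ nextY⊆X = inj₂ (⊆-next ∘ nextY⊆X)
    ... | inj₁ X⊆Y with cond tX X⊆Y
    ...   | inj₁ ≡.refl  = inj₂ id
    ...   | inj₂ nextX⊆Y = inj₁ nextX⊆Y
    compare {Y = Y} (limit C _ tC) tY cond with em {P = ∃[ S ] S ∈ₛ C × next Y ⊆ S}
    ... | yes (S , S∈C , nextY⊆S) = inj₂ (λ {x} → ⊆-⋃ {C} S∈C {x} ∘ nextY⊆S)
    ... | no  none = inj₁ λ {x} x∈ → below (∈-⋃⁻ {C} {x} x∈)
      where
      below : ∀ {x} → ∃[ S ] S ∈ₛ C × x ∈ₛ S → x ∈ₛ Y
      below (S , S∈C , x∈S) with compare (tC S∈C) tY cond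
      ... | inj₁ S⊆Y     = S⊆Y x∈S
      ... | inj₂ nextY⊆S = ⊥-elim (none (S , S∈C , nextY⊆S))

    -- Every member of the tower is extreme, by induction on `X`; this discharges the condition in
    -- `compare`.
    ⊆⇒≡⊎next⊆ : ∀ {X Y} → Tower X → Tower Y → Y ⊆ X → Y ≡ X ⊎ next Y ⊆ X
    ⊆⇒≡⊎next⊆ base tY Y⊆X = inj₁ (⊆-antisym Y⊆X (base⊆ tY))
    ⊆⇒≡⊎next⊆ (step tX) tY Y⊆nextX with compare tY tX (⊆⇒≡⊎next⊆ tX)
    ... | inj₂ nextX⊆Y = inj₁ (⊆-antisym Y⊆nextX nextX⊆Y)
    ... | inj₁ Y⊆X with ⊆⇒≡⊎next⊆ tX tY Y⊆X
    ...   | inj₁ ≡.refl  = inj₂ id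
    ...   | inj₂ nextY⊆X = inj₂ (⊆-next ∘ nextY⊆X)
    ⊆⇒≡⊎next⊆ {Y = Y} (limit C _ tC) tY Y⊆⋃ with em {P = ∃[ S ] S ∈ₛ C × ¬ S ⊆ Y}
    ... | no none = inj₁ (⊆-antisym Y⊆⋃ λ {x} x∈ → below (∈-⋃⁻ {C} {x} x∈))
      where
      below : ∀ {x} → ∃[ S ] S ∈ₛ C × x ∈ₛ S → x ∈ₛ Y
      below (S , S∈C , x∈S) with em {P = S ⊆ Y}
      ... | yes S⊆Y = S⊆Y x∈S
      ... | no  S⊈Y = ⊥-elim (none (S , S∈C , S⊈Y))
    ... | yes (S , S∈C , S⊈Y) with compare tY (tC S∈C) (⊆⇒≡⊎next⊆ (tC S∈C))
    ...   | inj₂ nextS⊆Y = ⊥-elim (S⊈Y (nextS⊆Y ∘ ⊆-next))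
    ...   | inj₁ Y⊆S with ⊆⇒≡⊎next⊆ (tC S∈C) tY Y⊆S
    ...     | inj₁ ≡.refl  = ⊥-elim (S⊈Y id)
    ...     | inj₂ nextY⊆S = inj₂ (λ {x} → ⊆-⋃ {C} S∈C {x} ∘ nextY⊆S)

    total : ∀ {X Y} → Tower X → Tower Y → X ⊆ Y ⊎ Y ⊆ X
    total tX tY with compare tX tY (⊆⇒≡⊎next⊆ tY)
    ... | inj₁ X⊆Y     = inj₁ X⊆Y
    ... | inj₂ nextY⊆X = inj₂ (nextY⊆X ∘ ⊆-next)

    ClosedUnderChains : Set (a ⊔ p)
    ClosedUnderChains = ∀ C → ∃[ S ] S ∈ₛ C → (∀ {S} → S ∈ₛ C → P S) →
      (∀ {S S′} → S ∈ₛ C → S′ ∈ₛ C → S ⊆ S′ ⊎ S′ ⊆ S) → P (⋃ C)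

    -- The union of the whole tower belongs to the tower, hence so does its successor, which is
    -- therefore contained in it.
    zorn : ClosedUnderChains → P B → ∃[ M ] B ⊆ M × P M × Maximal M
    zorn closed PB = M , base⊆ tM , satisfies tM , proj₂ (proj₂ (proj₂ (successor M))) nextM⊆M
      where
      satisfies : ∀ {S} → Tower S → P S
      satisfies base           = PB
      satisfies (step {S} tS)  = proj₁ (proj₂ (proj₂ (successor S))) (satisfies tS)
      satisfies (limit C C≠∅ tC) = closed C C≠∅ (λ S∈C → satisfies (tC S∈C)) (λ S∈C S′∈C → total (tC S∈C) (tC S′∈C))

      towers : Subset (Subset A)
      towers S = ⌊ em {P = Tower S} ⌋

      M : Subset A
      M = ⋃ towers

      tM : Tower M
      tM = limit towers (B , fromWitness base) toWitness

      nextM⊆M : next M ⊆ M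
      nextM⊆M {x} = ⊆-⋃ {towers} {next M} (fromWitness (step tM)) {x}

-- Monic polynomials over a field

module ClassicalField (em : ∀ {ℓ} → ExcludedMiddle ℓ) {c ℓ₁ ℓ₂} (F : HeytingField c ℓ₁ ℓ₂) where
  open FieldTheory F
  open HeytingField F using (tight)
  open CommutativeSemiringExp commutativeSemiring using (^-distrib-*; ^-congˡ)
  open RingProperties ring using (x∙y⁻¹≈ε⇒x≈y)
  open SetoidReasoning setoid
  open IntegerSolver commutativeRing

  ≉⇒# : ∀ {x} → ¬ x ≈ 0# → x # 0#
  ≉⇒# {x} x≉0 with em {P = x # 0#}
  ... | yes x#0 = x#0
  ... | no ¬x#0 = ⊥-elim (x≉0 (proj₁ (tight x 0#) ¬x#0))

  #⇒≉ : ∀ {x} → x # 0# → ¬ x ≈ 0#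
  #⇒≉ {x} x#0 x≈0 = proj₂ (tight x 0#) x≈0 x#0

  abstract
    invert : ∀ {x} → ¬ x ≈ 0# → ∃[ y ] x * y ≈ 1#
    invert x≉0 = #0⇒inverse (≉⇒# x≉0)

  1≉0 : ¬ 1# ≈ 0#
  1≉0 = #⇒≉ (inverse⇒#0 (*-identityˡ 1#))

  unit⇒≉0 : ∀ {x y} → x * y ≈ 1# → ¬ x ≈ 0#
  unit⇒≉0 xy≈1 = #⇒≉ (inverse⇒#0 xy≈1)

  x*y≈0⇒y≈0 : ∀ {x y} → ¬ x ≈ 0# → x * y ≈ 0# → y ≈ 0#
  x*y≈0⇒y≈0 {x} {y} x≉0 xy≈0 with invert x≉0
  ... | x′ , xx′≈1 = begin
    y            ≈⟨ *-identityˡ y ⟨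
    1# * y       ≈⟨ *-congʳ xx′≈1 ⟨
    x * x′ * y   ≈⟨ solve 3 (λ x x′ y → x :* x′ :* y := x′ :* (x :* y)) refl x x′ y ⟩
    x′ * (x * y) ≈⟨ *-congˡ xy≈0 ⟩
    x′ * 0#      ≈⟨ zeroʳ x′ ⟩
    0#           ∎

  *-≉0 : ∀ {x y} → ¬ x ≈ 0# → ¬ y ≈ 0# → ¬ x * y ≈ 0#
  *-≉0 x≉0 y≉0 xy≈0 = y≉0 (x*y≈0⇒y≈0 x≉0 xy≈0)

  *-cancelˡ-≈ : ∀ {x y z} → ¬ x ≈ 0# → x * y ≈ x * z → y ≈ z
  *-cancelˡ-≈ {x} {y} {z} x≉0 xy≈xz = x∙y⁻¹≈ε⇒x≈y y z (x*y≈0⇒y≈0 x≉0 (begin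
    x * (y - z)   ≈⟨ solve 3 (λ x y z → x :* (y :- z) := x :* y :- x :* z) refl x y z ⟩
    x * y - x * z ≈⟨ +-congʳ xy≈xz ⟩
    x * z - x * z ≈⟨ -‿inverseʳ _ ⟩
    0#            ∎))

  1^n≈1 : ∀ n → 1# ^ n ≈ 1#
  1^n≈1 zero    = refl
  1^n≈1 (suc n) = trans (*-identityˡ _) (1^n≈1 n)

  0^n≈0 : ∀ n → .{{_ : NonZero n}} → 0# ^ n ≈ 0#
  0^n≈0 (suc n) = zeroˡ _

  ^-unit : ∀ {x y} n → x * y ≈ 1# → x ^ n * y ^ n ≈ 1#
  ^-unit {x} {y} n xy≈1 = trans (sym (^-distrib-* x y n)) (trans (^-congˡ n xy≈1) (1^n≈1 n))

  ^-≉0 : ∀ {x} n → ¬ x ≈ 0# → ¬ x ^ n ≈ 0#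
  ^-≉0 n x≉0 = unit⇒≉0 (^-unit n (proj₂ (invert x≉0)))

  -- The vector lists the coefficients below an implicit leading 1, so its length is the degree.
  monic : ∀ {d} → Vec Carrier d → Carrier → Carrier
  monic []      x = 1#
  monic (c ∷ m) x = c + x * monic m x

  -- Horner's scheme: the coefficients of the quotient by X - z are the values at z of the
  -- successive tails.
  divideByRoot : ∀ {d} → Carrier → Vec Carrier (suc d) → Vec Carrier d
  divideByRoot z (c ∷ [])        = []
  divideByRoot z (c ∷ m@(_ ∷ _)) = monic m z ∷ divideByRoot z m

  monic-divide : ∀ {d} z (m : Vec Carrier (suc d)) x →
                 monic m x ≈ (x - z) * monic (divideByRoot z m) x + monic m z
  monic-divide z (c ∷ []) x =
    solve 4 (λ c x z u → c :+ x :* u := (x :- z) :* u :+ (c :+ z :* u)) refl c x z 1#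
  monic-divide z (c ∷ m@(_ ∷ _)) x = trans (+-congˡ (*-congˡ (monic-divide z m x)))
    (solve 5 (λ c x z q v → c :+ x :* ((x :- z) :* q :+ v) := (x :- z) :* (v :+ x :* q) :+ (c :+ z :* v))
       refl c x z (monic (divideByRoot z m) x) (monic m z))

  monic-factor : ∀ {d z} (m : Vec Carrier (suc d)) → monic m z ≈ 0# → ∀ x →
                 monic m x ≈ (x - z) * monic (divideByRoot z m) x
  monic-factor {z = z} m mz≈0 x = trans (monic-divide z m x) (trans (+-congˡ mz≈0) (+-identityʳ _))

  -- The last entry is minus the sum of the roots, and the division removes `z` from that sum.
  last-divide : ∀ {d} z (m : Vec Carrier (suc (suc d))) →
                Vec.last (divideByRoot z m) ≈ Vec.last m + z
  last-divide z (b ∷ c ∷ [])        = +-congˡ (*-identityʳ z)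
  last-divide z (b ∷ c ∷ m@(_ ∷ _)) = last-divide z (c ∷ m)

  module _ (closed : AlgebraicallyClosed) where

    monic-root : ∀ {d} (m : Vec Carrier (suc d)) → ∃[ z ] monic m z ≈ 0#
    monic-root (c ∷ m) with closed {c ∷ toList m ++ 1# ∷ []}
                              (nonConstant (Anyₚ.++⁺ʳ (toList m) (here (inverse⇒#0 (*-identityˡ 1#)))))
    ... | z , eq = z , trans (sym (evaluate-monic (c ∷ m))) eq
      where
      evaluate-monic : ∀ {d} (m : Vec Carrier d) → evaluate (toList m ++ 1# ∷ []) z ≈ monic m z
      evaluate-monic []      = trans (+-congˡ (zeroʳ z)) (+-identityʳ 1#)
      evaluate-monic (c ∷ m) = +-congˡ (*-congˡ (evaluate-monic m))

    monic-roots : ∀ {d} (m : Vec Carrier d) → ∃[ zs ] (∀ {x} → monic m x ≈ 0# → Any (x ≈_) zs)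
    monic-roots [] = [] , λ 1≈0 → ⊥-elim (1≉0 1≈0)
    monic-roots m@(_ ∷ _) with monic-root m
    ... | z , mz≈0 with monic-roots (divideByRoot z m)
    ...   | zs , complete = z ∷ zs , λ {x} → covered {x}
      where
      covered : ∀ {x} → monic m x ≈ 0# → Any (x ≈_) (z ∷ zs)
      covered {x} mx≈0 with em {P = x - z ≈ 0#}
      ... | yes x-z≈0 = here (x∙y⁻¹≈ε⇒x≈y x z x-z≈0)
      ... | no  x-z≉0 = there (complete (x*y≈0⇒y≈0 x-z≉0 (trans (sym (monic-factor m mz≈0 x)) mx≈0)))

    -- Each division by a root takes one `γ` out of the sum of the roots, and every root of the
    -- quotient is again `γ`.
    last-of-singleRooted : ∀ {d γ} (m : Vec Carrier (suc d)) → (∀ {x} → monic m x ≈ 0# → x ≈ γ) →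
                           Vec.last m ≈ - ((suc d · 1#) * γ)
    last-of-singleRooted {zero} {γ} m@(c ∷ []) single with monic-root m
    ... | z , eq = begin
      c                     ≈⟨ solve 3 (λ c z u → c := (c :+ z :* u) :- (z :* u)) refl c z 1# ⟩
      (c + z * 1#) - z * 1# ≈⟨ +-cong eq (-‿cong (*-congʳ (single eq))) ⟩
      0# - γ * 1#           ≈⟨ solve 2 (λ γ u → con 0ℤ :- γ :* u := :- ((u :+ con 0ℤ) :* γ)) refl γ 1# ⟩
      - ((1# + 0#) * γ)     ∎
    last-of-singleRooted {suc d} {γ} m single with monic-root m
    ... | z , eq = begin
      Vec.last m                        ≈⟨ solve 2 (λ l z → l := l :+ z :- z) refl (Vec.last m) z ⟩
      Vec.last m + z - z                ≈⟨ +-congʳ (last-divide z m) ⟨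
      Vec.last (divideByRoot z m) - z   ≈⟨ +-cong (last-of-singleRooted (divideByRoot z m) rootsOfQuotient) (-‿cong (single eq)) ⟩
      - (suc d · 1# * γ) - γ            ≈⟨ solve 2 (λ k γ → :- (k :* γ) :- γ := :- ((con 1ℤ :+ k) :* γ)) refl (suc d · 1#) γ ⟩
      - ((1# + suc d · 1#) * γ)         ∎
      where
      rootsOfQuotient : ∀ {x} → monic (divideByRoot z m) x ≈ 0# → x ≈ γ
      rootsOfQuotient {x} qx≈0 = single (trans (monic-factor m eq x) (trans (*-congˡ qx≈0) (zeroʳ _)))

-- Simple algebraic extensions

least : (∀ {ℓ} → ExcludedMiddle ℓ) → ∀ {p} (P : ℕ → Set p) {n} → P n →
        ∃[ m ] P m × (∀ {k} → k < m → ¬ P k)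
least em P {n} = <-rec _ search n
  where
  search : ∀ n → (∀ {k} → k < n → P k → ∃[ m ] P m × (∀ {k} → k < m → ¬ P k)) →
           P n → ∃[ m ] P m × (∀ {k} → k < m → ¬ P k)
  search n rec Pn with em {P = ∃[ k ] k < n × P k}
  ... | yes (k , k<n , Pk) = rec k<n Pk
  ... | no  none           = n , Pn , λ k<n Pk → none (_ , k<n , Pk)

module CoefficientLists {r ℓᵣ} (R : RawRing r ℓᵣ) where
  private module R = RawRing R

  infixl 6 _⊞_
  infixl 7 _⊠_

  _⊞_ : List R.Carrier → List R.Carrier → List R.Carrier
  []      ⊞ g       = g
  (a ∷ f) ⊞ []      = a ∷ f
  (a ∷ f) ⊞ (b ∷ g) = a R.+ b ∷ f ⊞ g

  scale : R.Carrier → List R.Carrier → List R.Carrier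
  scale a = List.map (a R.*_)

  _⊠_ : List R.Carrier → List R.Carrier → List R.Carrier
  []      ⊠ g = []
  (a ∷ f) ⊠ g = scale a g ⊞ (R.0# ∷ f ⊠ g)

  subtractMultiple : ∀ {d} → Vec R.Carrier d → R.Carrier → Vec R.Carrier d → Vec R.Carrier d
  subtractMultiple u y m = Vec.zipWith (λ a b → a R.+ R.- (y R.* b)) u m

  -- The remainder of a polynomial modulo Xᵉ⁺¹ + m.
  reduce : ∀ {e} → Vec R.Carrier (suc e) → List R.Carrier → Vec R.Carrier (suc e)
  reduce m []      = Vec.replicate _ R.0#
  reduce m (c ∷ f) with initLast (reduce m f)
  ... | ys , y , _ = subtractMultiple (c ∷ ys) y m

module Evaluation (em : ∀ {ℓ} → ExcludedMiddle ℓ) {c ℓ₁ ℓ₂} (F : HeytingField c ℓ₁ ℓ₂)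
  {r ℓᵣ} (R : RawRing r ℓᵣ) (φ : RawRing.Carrier R → FieldTheory.Carrier F)
  (hom : RingMorphisms.IsRingHomomorphism R (FieldTheory.rawRing F) φ) where
  private module R = RawRing R
  open FieldTheory F
  open ClassicalField em F
  open CoefficientLists R
  open RingMorphisms.IsRingHomomorphism hom
  open SetoidReasoning setoid
  open IntegerSolver commutativeRing

  ev : List R.Carrier → Carrier → Carrier
  ev f = evaluate (List.map φ f)

  evᵛ : ∀ {d} → Vec R.Carrier d → Carrier → Carrier
  evᵛ v = ev (toList v)

  evᵐ : ∀ {d} → Vec R.Carrier d → Carrier → Carrier
  evᵐ m = monic (Vec.map φ m)

  ev-⊞ : ∀ f g x → ev (f ⊞ g) x ≈ ev f x + ev g x
  ev-⊞ []      g       x = sym (+-identityˡ _)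
  ev-⊞ (a ∷ f) []      x = sym (+-identityʳ _)
  ev-⊞ (a ∷ f) (b ∷ g) x = trans (+-cong (+-homo a b) (*-congˡ (ev-⊞ f g x)))
    (solve 5 (λ a b x f g → (a :+ b) :+ x :* (f :+ g) := (a :+ x :* f) :+ (b :+ x :* g))
      refl (φ a) (φ b) x (ev f x) (ev g x))

  ev-scale : ∀ a f x → ev (scale a f) x ≈ φ a * ev f x
  ev-scale a []      x = sym (zeroʳ _)
  ev-scale a (b ∷ f) x = trans (+-cong (*-homo a b) (*-congˡ (ev-scale a f x)))
    (solve 4 (λ a b x f → a :* b :+ x :* (a :* f) := a :* (b :+ x :* f)) refl (φ a) (φ b) x (ev f x))

  ev-⊠ : ∀ f g x → ev (f ⊠ g) x ≈ ev f x * ev g x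
  ev-⊠ []      g x = sym (zeroˡ _)
  ev-⊠ (a ∷ f) g x = begin
    ev (scale a g ⊞ (R.0# ∷ f ⊠ g)) x           ≈⟨ ev-⊞ (scale a g) (R.0# ∷ f ⊠ g) x ⟩
    ev (scale a g) x + (φ R.0# + x * ev (f ⊠ g) x)
      ≈⟨ +-cong (ev-scale a g x) (+-cong 0#-homo (*-congˡ (ev-⊠ f g x))) ⟩
    φ a * ev g x + (0# + x * (ev f x * ev g x))
      ≈⟨ solve 4 (λ a g x f → a :* g :+ (con 0ℤ :+ x :* (f :* g)) := (a :+ x :* f) :* g) refl (φ a) (ev g x) x (ev f x) ⟩
    (φ a + x * ev f x) * ev g x                  ∎

  ev-constant : ∀ a x → ev (a ∷ []) x ≈ φ a
  ev-constant a x = trans (+-congˡ (zeroʳ x)) (+-identityʳ _)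

  ev-X : ∀ x → ev (R.0# ∷ R.1# ∷ []) x ≈ x
  ev-X x = trans (+-cong 0#-homo (*-congˡ (trans (ev-constant R.1# x) 1#-homo)))
                 (trans (+-identityˡ _) (*-identityʳ x))

  ev-∷ʳ : ∀ {d} (ys : Vec R.Carrier d) y x → evᵛ (ys ∷ʳ y) x ≈ evᵛ ys x + φ y * x ^ d
  ev-∷ʳ [] y x = solve 2 (λ y x → y :+ x :* con 0ℤ := con 0ℤ :+ y :* con 1ℤ) refl (φ y) x
  ev-∷ʳ {suc d} (a ∷ ys) y x = trans (+-congˡ (*-congˡ (ev-∷ʳ ys y x)))
    (solve 5 (λ a x f y p → a :+ x :* (f :+ y :* p) := (a :+ x :* f) :+ y :* (x :* p))
      refl (φ a) x (evᵛ ys x) (φ y) (x ^ d))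

  evᵐ≈evᵛ+x^d : ∀ {d} (m : Vec R.Carrier d) x → evᵐ m x ≈ evᵛ m x + x ^ d
  evᵐ≈evᵛ+x^d []              x = sym (+-identityˡ _)
  evᵐ≈evᵛ+x^d {suc d} (a ∷ m) x = trans (+-congˡ (*-congˡ (evᵐ≈evᵛ+x^d m x)))
    (solve 4 (λ a x f p → a :+ x :* (f :+ p) := (a :+ x :* f) :+ x :* p) refl (φ a) x (evᵛ m x) (x ^ d))

  ev-subtractMultiple : ∀ {d} (u : Vec R.Carrier d) y m x →
                        evᵛ (subtractMultiple u y m) x ≈ evᵛ u x - φ y * evᵛ m x
  ev-subtractMultiple [] y [] x = solve 1 (λ y → con 0ℤ := con 0ℤ :- y :* con 0ℤ) refl (φ y)
  ev-subtractMultiple (a ∷ u) y (b ∷ m) x = trans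
    (+-cong (trans (+-homo a _) (+-congˡ (trans (-‿homo _) (-‿cong (*-homo y b)))))
            (*-congˡ (ev-subtractMultiple u y m x)))
    (solve 6 (λ a y b x f g → (a :- y :* b) :+ x :* (f :- y :* g) := (a :+ x :* f) :- y :* (b :+ x :* g))
      refl (φ a) (φ y) (φ b) x (evᵛ u x) (evᵛ m x))

  ev-zeros : ∀ d x → evᵛ (Vec.replicate d R.0#) x ≈ 0#
  ev-zeros zero    x = refl
  ev-zeros (suc d) x = trans (+-cong 0#-homo (trans (*-congˡ (ev-zeros d x)) (zeroʳ x))) (+-identityˡ 0#)

  -- Prepending a coefficient shifts the remainder, pushing its top coefficient `y` into degree
  -- `suc e`; at a root of the modulus that power of `x` equals minus the value of `m`.
  ev-reduce : ∀ {e} (m : Vec R.Carrier (suc e)) {x} → evᵐ m x ≈ 0# → ∀ f → evᵛ (reduce m f) x ≈ ev f x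
  ev-reduce {e} m {x} mx≈0 [] = ev-zeros (suc e) x
  ev-reduce {e} m {x} mx≈0 (c ∷ f) with reduce m f | ev-reduce m mx≈0 f
  ... | v | ih with initLast v
  ...   | ys , y , ≡.refl = begin
    evᵛ (subtractMultiple (c ∷ ys) y m) x      ≈⟨ ev-subtractMultiple (c ∷ ys) y m x ⟩
    (φ c + x * evᵛ ys x) - φ y * evᵛ m x
      ≈⟨ solve 6 (λ c x f y g p → (c :+ x :* f) :- y :* g := (c :+ x :* (f :+ y :* p)) :- y :* (g :+ x :* p))
           refl (φ c) x (evᵛ ys x) (φ y) (evᵛ m x) (x ^ e) ⟩
    (φ c + x * (evᵛ ys x + φ y * x ^ e)) - φ y * (evᵛ m x + x ^ suc e)
      ≈⟨ +-cong (+-congˡ (*-congˡ (trans (sym (ev-∷ʳ ys y x)) ih)))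
                (-‿cong (*-congˡ (trans (sym (evᵐ≈evᵛ+x^d m x)) mx≈0))) ⟩
    (φ c + x * ev f x) - φ y * 0#
      ≈⟨ solve 2 (λ a y → a :- y :* con 0ℤ := a) refl (φ c + x * ev f x) (φ y) ⟩
    φ c + x * ev f x                          ∎

-- The image of φ₁ is a field and φ₂ factors through it: the data amount to the
-- embedding φ₂ ∘ φ₁⁻¹ of the subfield φ₁(R) into F.
module Extension (em : ∀ {ℓ} → ExcludedMiddle ℓ) {c ℓ₁ ℓ₂} (F : HeytingField c ℓ₁ ℓ₂)
  {r ℓᵣ} (R : RawRing r ℓᵣ) (φ₁ φ₂ : RawRing.Carrier R → FieldTheory.Carrier F)
  (hom₁ : RingMorphisms.IsRingHomomorphism R (FieldTheory.rawRing F) φ₁)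
  (hom₂ : RingMorphisms.IsRingHomomorphism R (FieldTheory.rawRing F) φ₂)
  (factors : ∀ a → FieldTheory._≈_ F (φ₁ a) (FieldTheory.0# F) → FieldTheory._≈_ F (φ₂ a) (FieldTheory.0# F))
  (invertible : ∀ a → ¬ FieldTheory._≈_ F (φ₁ a) (FieldTheory.0# F) →
    ∃[ b ] FieldTheory._≈_ F (FieldTheory._*_ F (φ₁ b) (φ₁ a)) (FieldTheory.1# F)) where
  open FieldTheory F
  private
    module R = RawRing R
    module E₁ = Evaluation em F R φ₁ hom₁
    module E₂ = Evaluation em F R φ₂ hom₂
    module φ₁ = RingMorphisms.IsRingHomomorphism hom₁
  open ClassicalField em F
  open CoefficientLists R
  open SetoidReasoning setoid
  open IntegerSolver commutativeRing

  -- The bound on `d` is there to contradict minimality when `f` is a remainder.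
  Monicised : List R.Carrier → Set _
  Monicised f = ∃[ d ] d < length f × ∃[ m ] ∃[ a ] ¬ φ₁ a ≈ 0# ×
                (∀ x → E₁.ev f x ≈ φ₁ a * E₁.evᵐ {d} m x)

  -- `φ₁` may be non-injective on the raw ring, so being the zero polynomial is judged after
  -- applying `φ₁`.
  Vanishing : List R.Carrier → Set _
  Vanishing = All (λ a → φ₁ a ≈ 0#)

  ev-Vanishing : ∀ {f} → Vanishing f → ∀ x → E₁.ev f x ≈ 0# × E₂.ev f x ≈ 0#
  ev-Vanishing []          x = refl , refl
  ev-Vanishing (c≈0 ∷ f≈0) x with ev-Vanishing f≈0 x
  ... | f₁≈0 , f₂≈0 = vanish c≈0 f₁≈0 , vanish (factors _ c≈0) f₂≈0
    where
    vanish : ∀ {a b} → a ≈ 0# → b ≈ 0# → a + x * b ≈ 0#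
    vanish a≈0 b≈0 = trans (+-cong a≈0 (trans (*-congˡ b≈0) (zeroʳ x))) (+-identityˡ 0#)

  monicise : ∀ f → Vanishing f ⊎ Monicised f
  monicise [] = inj₁ []
  monicise (c ∷ f) with monicise f
  ... | inj₂ (d , d<n , m , a , φa≉0 , eq) with invertible a φa≉0
  ...   | b , ba≈1 = inj₂ (suc d , s≤s d<n , b R.* c ∷ m , a , φa≉0 , λ x → sym (begin
    φ₁ a * (φ₁ (b R.* c) + x * E₁.evᵐ m x)          ≈⟨ *-congˡ (+-congʳ (φ₁.*-homo b c)) ⟩
    φ₁ a * (φ₁ b * φ₁ c + x * E₁.evᵐ m x)
      ≈⟨ solve 5 (λ a b c x m → a :* (b :* c :+ x :* m) := (b :* a) :* c :+ x :* (a :* m)) refl (φ₁ a) (φ₁ b) (φ₁ c) x (E₁.evᵐ m x) ⟩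
    (φ₁ b * φ₁ a) * φ₁ c + x * (φ₁ a * E₁.evᵐ m x)  ≈⟨ +-cong (trans (*-congʳ ba≈1) (*-identityˡ _)) (*-congˡ (sym (eq x))) ⟩
    φ₁ c + x * E₁.ev f x                            ∎))
  monicise (c ∷ f) | inj₁ f≈0 with em {P = φ₁ c ≈ 0#}
  ... | yes c≈0 = inj₁ (c≈0 ∷ f≈0)
  ... | no  c≉0 = inj₂ (0 , s≤s z≤n , [] , c , c≉0 , λ x → trans
    (trans (+-congˡ (trans (*-congˡ (proj₁ (ev-Vanishing f≈0 x))) (zeroʳ x))) (+-identityʳ _)) (sym (*-identityʳ _)))

  Annihilates : Carrier → ℕ → Set _
  Annihilates β d = ∃[ m ] E₁.evᵐ {d} m β ≈ 0#

  module Minimal {β : Carrier} {e : ℕ} (m : Vec R.Carrier (suc e)) (mβ≈0 : E₁.evᵐ m β ≈ 0#)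
    (minimal : ∀ {k} → k < suc e → ¬ Annihilates β k) where

    -- This makes β ↦ β′ well defined. The remainder of `f` modulo `m` vanishes at `β` and has
    -- degree below the minimal one, so all its coefficients die under `φ₁`, hence under `φ₂`; and
    -- reduction does not change values at roots of the modulus.
    transfer : ∀ {β′} → E₂.evᵐ m β′ ≈ 0# → ∀ f → E₁.ev f β ≈ 0# → E₂.ev f β′ ≈ 0#
    transfer {β′} mβ′≈0 f fβ≈0 with monicise (toList (reduce m f))
    ... | inj₁ vanishing = trans (sym (E₂.ev-reduce m mβ′≈0 f)) (proj₂ (ev-Vanishing vanishing β′))
    ... | inj₂ (d , d<n , m′ , a , φa≉0 , eq) = ⊥-elim (minimal (≡.subst (d <_) (length-toList (reduce m f)) d<n)
      (m′ , x*y≈0⇒y≈0 φa≉0 (trans (sym (eq β)) (trans (E₁.ev-reduce m mβ≈0 f) fβ≈0))))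

  minimalPolynomial : ∀ {β d} → Annihilates β d →
    ∃[ e ] Σ (Vec R.Carrier (suc e)) λ m → E₁.evᵐ m β ≈ 0# × (∀ {k} → k < suc e → ¬ Annihilates β k)
  minimalPolynomial {β} annihilates with least em (Annihilates β) annihilates
  ... | zero  , ([] , 1≈0)   , _       = ⊥-elim (1≉0 1≈0)
  ... | suc e , (m , mβ≈0) , minimal = e , m , mβ≈0 , minimal

  annihilates-nonVanishing : ∀ {β} f → ¬ Vanishing f → E₁.ev f β ≈ 0# → ∃[ d ] Annihilates β d
  annihilates-nonVanishing {β} f f≉0 fβ≈0 with monicise f
  ... | inj₁ f≈0                          = ⊥-elim (f≉0 f≈0)
  ... | inj₂ (d , _ , m , a , φa≉0 , eq) = d , m , x*y≈0⇒y≈0 φa≉0 (trans (sym (eq β)) fβ≈0)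

-- Automorphisms of the algebraic closure

module _ {r ℓᵣ s ℓₛ} {R : RawRing r ℓᵣ} {S : RawRing s ℓₛ} where
  private
    module R = RawRing R
    module S = RawRing S

  ringHomomorphism : (φ : R.Carrier → S.Carrier) → (∀ {x y} → x R.≈ y → φ x S.≈ φ y) →
    (∀ x y → φ (x R.+ y) S.≈ (φ x S.+ φ y)) → φ R.0# S.≈ S.0# →
    (∀ x y → φ (x R.* y) S.≈ (φ x S.* φ y)) → φ R.1# S.≈ S.1# →
    (∀ x → φ (R.- x) S.≈ (S.- φ x)) → RingMorphisms.IsRingHomomorphism R S φ
  ringHomomorphism φ cong +-homo 0-homo *-homo 1-homo -‿homo = record
    { isSemiringHomomorphism = record
      { isNearSemiringHomomorphism = record
        { +-isMonoidHomomorphism = record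
          { isMagmaHomomorphism = record { isRelHomomorphism = record { cong = cong } ; homo = +-homo }
          ; ε-homo = 0-homo
          }
        ; *-homo = *-homo
        }
      ; 1#-homo = 1-homo
      }
    ; -‿homo = -‿homo
    }

module GaloisTheory (em : ∀ {ℓ} → ExcludedMiddle ℓ) (ext : ∀ {ℓ ℓ′} → Extensionality ℓ ℓ′)
  {c ℓ₁ ℓ₂ c′ ℓ₁′ ℓ₂′} {K : HeytingField c ℓ₁ ℓ₂} (K̄ : AlgebraicClosure K c′ ℓ₁′ ℓ₂′) where
  private
    module K where
      open FieldTheory K public
      open ClassicalField em K public
  open AlgebraicClosure K̄
  open ClassicalField em heytingField
  open AbsoluteGalois K̄ using (Automorphism)
  open SetoidReasoning setoid
  open IntegerSolver commutativeRing
  open RingProperties ring using (x∙y⁻¹≈ε⇒x≈y)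
  private module embed = RingMorphisms.IsRingHomomorphism isRingHomomorphism

  embed-unit : ∀ {x y} → x K.* y K.≈ K.1# → embed x * embed y ≈ 1#
  embed-unit xy≈1 = trans (sym (embed.*-homo _ _)) (trans (embed.⟦⟧-cong xy≈1) embed.1#-homo)

  embed-#0 : ∀ {x} → x K.# K.0# → ¬ embed x ≈ 0#
  embed-#0 x#0 = unit⇒≉0 (embed-unit (proj₂ (K.#0⇒inverse x#0)))

  embed-≉0 : ∀ {x} → ¬ x K.≈ K.0# → ¬ embed x ≈ 0#
  embed-≉0 x≉0 = embed-#0 (K.≉⇒# x≉0)

  embed-injective : ∀ {x y} → embed x ≈ embed y → x K.≈ y
  embed-injective {x} {y} eq with em {P = x K.- y K.≈ K.0#}
  ... | yes x-y≈0 = RingProperties.x∙y⁻¹≈ε⇒x≈y K.ring x y x-y≈0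
  ... | no  x-y≉0 = ⊥-elim (embed-≉0 x-y≉0 (begin
    embed (x K.- y)       ≈⟨ embed.+-homo x (K.- y) ⟩
    embed x + embed (K.- y) ≈⟨ +-cong eq (embed.-‿homo y) ⟩
    embed y - embed y     ≈⟨ -‿inverseʳ _ ⟩
    0#                    ∎))

  embed-invertible : ∀ a → ¬ embed a ≈ 0# → ∃[ b ] embed b * embed a ≈ 1#
  embed-invertible a a≉0 with K.invert (λ a≈0 → a≉0 (trans (embed.⟦⟧-cong a≈0) embed.0#-homo))
  ... | b , ab≈1 = b , trans (*-comm _ _) (embed-unit ab≈1)

  module Base = Extension em heytingField K.rawRing embed embed isRingHomomorphism isRingHomomorphism
                  (λ _ a≈0 → a≈0) embed-invertible
  open Evaluation em heytingField K.rawRing embed isRingHomomorphism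

  annihilator : ∀ x → ∃[ f ] ¬ Base.Vanishing f × ev f x ≈ 0#
  annihilator x with algebraic x
  ... | _ , K.nonConstant {c₀} {cs} cs#0 , eq = c₀ ∷ cs , (λ { (_ ∷ cs≈0) → contradict cs#0 cs≈0 }) , eq
    where
    contradict : ∀ {cs} → Any (K._# K.0#) cs → Base.Vanishing cs → ⊥
    contradict (here a#0)   (a≈0 ∷ _)    = embed-#0 a#0 a≈0
    contradict (there cs#0) (_   ∷ cs≈0) = contradict cs#0 cs≈0

  -- A polynomial relation of x ≉ 0 over K, divided by a power of x, gets a non-zero constant term.
  constantTerm : ∀ {x} → ¬ x ≈ 0# → ∃[ k ] ∃[ g ] ¬ embed k ≈ 0# × embed k + x * ev g x ≈ 0#
  constantTerm {x} x≉0 with annihilator x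
  ... | f , f≉0 , fx≈0 = strip f f≉0 fx≈0
    where
    strip : ∀ f → ¬ Base.Vanishing f → ev f x ≈ 0# → ∃[ k ] ∃[ g ] ¬ embed k ≈ 0# × embed k + x * ev g x ≈ 0#
    strip []      f≉0 _ = ⊥-elim (f≉0 [])
    strip (k ∷ g) f≉0 fx≈0 with em {P = embed k ≈ 0#}
    ... | no  k≉0 = k , g , k≉0 , fx≈0
    ... | yes k≈0 = strip g (λ g≈0 → f≉0 (k≈0 ∷ g≈0))
      (x*y≈0⇒y≈0 x≉0 (trans (sym (+-identityˡ _)) (trans (+-congʳ (sym k≈0)) fx≈0)))

  Relation : Set c′
  Relation = Subset (Carrier × Carrier)

  -- The graph of a K-algebra homomorphism from a K-subalgebra of K̄ into K̄.  The notion is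
  -- symmetric (zero⇐zero), so a maximal one is total in both directions: an automorphism.
  record PartialHom (S : Relation) : Set (c ⊔ c′ ⊔ ℓ₁′) where
    field
      resp   : ∀ {x x′ y y′} → x ≈ x′ → y ≈ y′ → (x , y) ∈ₛ S → (x′ , y′) ∈ₛ S
      scalar : ∀ k → (embed k , embed k) ∈ₛ S
      add    : ∀ {x y x′ y′} → (x , y) ∈ₛ S → (x′ , y′) ∈ₛ S → (x + x′ , y + y′) ∈ₛ S
      mul    : ∀ {x y x′ y′} → (x , y) ∈ₛ S → (x′ , y′) ∈ₛ S → (x * x′ , y * y′) ∈ₛ S
      neg    : ∀ {x y} → (x , y) ∈ₛ S → (- x , - y) ∈ₛ S
      zero⇒zero : ∀ {x y} → (x , y) ∈ₛ S → x ≈ 0# → y ≈ 0#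

    0∈ : (0# , 0#) ∈ₛ S
    0∈ = resp embed.0#-homo embed.0#-homo (scalar K.0#)

    1∈ : (1# , 1#) ∈ₛ S
    1∈ = resp embed.1#-homo embed.1#-homo (scalar K.1#)

    polynomial : ∀ {x y} → (x , y) ∈ₛ S → ∀ g → (ev g x , ev g y) ∈ₛ S
    polynomial xy∈S []      = 0∈
    polynomial xy∈S (k ∷ g) = add (scalar k) (mul xy∈S (polynomial xy∈S g))

    -- The homomorphism carries the relation k + x·g(x) = 0 to k + y·g(y) = 0, so y = 0 would force
    -- k = 0.
    zero⇐zero : ∀ {x y} → (x , y) ∈ₛ S → y ≈ 0# → x ≈ 0#
    zero⇐zero {x} {y} xy∈S y≈0 with em {P = x ≈ 0#}
    ... | yes x≈0 = x≈0
    ... | no  x≉0 with constantTerm x≉0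
    ...   | k , g , k≉0 , eq = ⊥-elim (k≉0 (begin
      embed k              ≈⟨ +-identityʳ _ ⟨
      embed k + 0#         ≈⟨ +-congˡ (trans (*-congʳ y≈0) (zeroˡ _)) ⟨
      embed k + y * ev g y ≈⟨ zero⇒zero (add (scalar k) (mul xy∈S (polynomial xy∈S g))) eq ⟩
      0#                   ∎))

    -- From k + x·g(x) = 0 the inverse of x is -g(x)/k, a polynomial in x over K, so the domain
    -- contains it.
    invertible : ∀ {x y} → (x , y) ∈ₛ S → ¬ x ≈ 0# → ∃[ u ] ∃[ v ] (u , v) ∈ₛ S × u * x ≈ 1#
    invertible {x} {y} xy∈S x≉0 with constantTerm x≉0
    ... | k , g , k≉0 , eq with embed-invertible k k≉0
    ...   | k′ , k′k≈1 = _ , _ , mul (neg (scalar k′)) (polynomial xy∈S g) , (begin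
      - embed k′ * ev g x * x
        ≈⟨ solve 4 (λ k′ p x k → :- k′ :* p :* x := k′ :* k :- k′ :* (k :+ x :* p)) refl (embed k′) (ev g x) x (embed k) ⟩
      embed k′ * embed k - embed k′ * (embed k + x * ev g x)
        ≈⟨ +-cong k′k≈1 (-‿cong (*-congˡ eq)) ⟩
      1# - embed k′ * 0#       ≈⟨ solve 1 (λ k → con 1ℤ :- k :* con 0ℤ := con 1ℤ) refl (embed k′) ⟩
      1#                       ∎)

    functional : ∀ {x x′ y y′} → (x , y) ∈ₛ S → (x′ , y′) ∈ₛ S → x ≈ x′ → y ≈ y′
    functional {x} {x′} {y} {y′} xy∈S x′y′∈S x≈x′ = x∙y⁻¹≈ε⇒x≈y y y′
      (zero⇒zero (add xy∈S (neg x′y′∈S)) (trans (+-congʳ x≈x′) (-‿inverseʳ x′)))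

  swapped : ∀ {S} → PartialHom S → PartialHom (S ∘ swap)
  swapped S-hom = record
    { resp = λ x≈ y≈ → resp y≈ x≈ ; scalar = scalar ; add = add ; mul = mul ; neg = neg ; zero⇒zero = zero⇐zero }
    where open PartialHom S-hom

  -- Common form of the two situations in which an element is adjoined: to K itself, for the fixed
  -- field, and to the domain of a partial homomorphism, for the maximality argument.
  record Embedding r ℓᵣ : Set (lsuc (r ⊔ ℓᵣ) ⊔ c ⊔ c′ ⊔ ℓ₁′) where
    field
      R          : RawRing r ℓᵣ
      φ₁ φ₂      : RawRing.Carrier R → Carrier
      hom₁       : RingMorphisms.IsRingHomomorphism R rawRing φ₁
      hom₂       : RingMorphisms.IsRingHomomorphism R rawRing φ₂
      factors    : ∀ a → φ₁ a ≈ 0# → φ₂ a ≈ 0#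
      invertible : ∀ a → ¬ φ₁ a ≈ 0# → ∃[ b ] φ₁ b * φ₁ a ≈ 1#
      ι          : K.Carrier → RawRing.Carrier R
      φ₁-ι       : ∀ k → φ₁ (ι k) ≈ embed k
      φ₂-ι       : ∀ k → φ₂ (ι k) ≈ embed k

  baseEmbedding : Embedding c ℓ₁
  baseEmbedding = record
    { R = K.rawRing ; φ₁ = embed ; φ₂ = embed ; hom₁ = isRingHomomorphism ; hom₂ = isRingHomomorphism
    ; factors = λ _ a≈0 → a≈0 ; invertible = embed-invertible
    ; ι = λ k → k ; φ₁-ι = λ _ → refl ; φ₂-ι = λ _ → refl }

  -- The graph itself is the ring; its projections are the inclusion of the domain and the
  -- homomorphism.
  partialEmbedding : ∀ {S} → PartialHom S → Embedding c′ ℓ₁′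
  partialEmbedding {S} S-hom = record
    { R = record
      { Carrier = ∃[ x ] ∃[ y ] (x , y) ∈ₛ S
      ; _≈_ = λ (x , y , _) (x′ , y′ , _) → x ≈ x′ × y ≈ y′
      ; _+_ = λ (_ , _ , s) (_ , _ , t) → _ , _ , add s t
      ; _*_ = λ (_ , _ , s) (_ , _ , t) → _ , _ , mul s t
      ; -_  = λ (_ , _ , s) → _ , _ , neg s
      ; 0#  = _ , _ , 0∈
      ; 1#  = _ , _ , 1∈
      }
    ; φ₁ = proj₁
    ; φ₂ = λ (_ , y , _) → y
    ; hom₁ = ringHomomorphism proj₁ proj₁ (λ _ _ → refl) refl (λ _ _ → refl) refl (λ _ → refl)
    ; hom₂ = ringHomomorphism (λ (_ , y , _) → y) proj₂ (λ _ _ → refl) refl (λ _ _ → refl) refl (λ _ → refl)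
    ; factors = λ (_ , _ , s) → zero⇒zero s
    ; invertible = λ (_ , _ , s) x≉0 → let (u , v , t , ux≈1) = invertible s x≉0 in (u , v , t) , ux≈1
    ; ι = λ k → embed k , embed k , scalar k
    ; φ₁-ι = λ _ → refl
    ; φ₂-ι = λ _ → refl
    }
    where open PartialHom S-hom

  module Adjoin {r ℓᵣ} (E : Embedding r ℓᵣ) (β : Carrier) where
    open Embedding E
    open Extension em heytingField R φ₁ φ₂ hom₁ hom₂ factors invertible
    open CoefficientLists R
    private
      module R  = RawRing R
      module E₁ = Evaluation em heytingField R φ₁ hom₁
      module E₂ = Evaluation em heytingField R φ₂ hom₂

    annihilates : ∃[ d ] Annihilates β d
    annihilates with annihilator β
    ... | f , f≉0 , fβ≈0 with Base.annihilates-nonVanishing f f≉0 fβ≈0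
    ...   | d , m , mβ≈0 = d , Vec.map ι m , trans (monic-ι m) mβ≈0
      where
      monic-ι : ∀ {d} (m : Vec K.Carrier d) → E₁.evᵐ (Vec.map ι m) β ≈ evᵐ m β
      monic-ι []      = refl
      monic-ι (k ∷ m) = +-cong (φ₁-ι k) (*-congˡ (monic-ι m))

    abstract
      minpoly : ∃[ e ] Σ (Vec R.Carrier (suc e)) λ m → E₁.evᵐ m β ≈ 0# × (∀ {k} → k < suc e → ¬ Annihilates β k)
      minpoly = minimalPolynomial (proj₂ annihilates)

    degree-1 : ℕ
    degree-1 = proj₁ minpoly

    m : Vec R.Carrier (suc degree-1)
    m = proj₁ (proj₂ minpoly)

    open Minimal {β} m (proj₁ (proj₂ (proj₂ minpoly))) (proj₂ (proj₂ (proj₂ minpoly)))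

    module _ {β′ : Carrier} (mβ′≈0 : E₂.evᵐ m β′ ≈ 0#) where

      Graph : Carrier × Carrier → Set _
      Graph (x , y) = ∃[ f ] E₁.ev f β ≈ x × E₂.ev f β′ ≈ y

      graph : Relation
      graph xy = ⌊ em {P = Graph xy} ⌋

      constant∈ : ∀ a → (φ₁ a , φ₂ a) ∈ₛ graph
      constant∈ a = fromWitness (a ∷ [] , E₁.ev-constant a β , E₂.ev-constant a β′)

      X∈ : (β , β′) ∈ₛ graph
      X∈ = fromWitness (R.0# ∷ R.1# ∷ [] , E₁.ev-X β , E₂.ev-X β′)

      graph-partialHom : PartialHom graph
      graph-partialHom = record
        { resp = resp
        ; scalar = λ k → resp (φ₁-ι k) (φ₂-ι k) (constant∈ (ι k))
        ; add = λ xy∈ x′y′∈ → fromWitness (add (toWitness xy∈) (toWitness x′y′∈))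
        ; mul = λ xy∈ x′y′∈ → fromWitness (mul (toWitness xy∈) (toWitness x′y′∈))
        ; neg = λ xy∈ → fromWitness (neg (toWitness xy∈))
        ; zero⇒zero = λ xy∈ → zero⇒zero (toWitness xy∈)
        }
        where
        resp : ∀ {x x′ y y′} → x ≈ x′ → y ≈ y′ → (x , y) ∈ₛ graph → (x′ , y′) ∈ₛ graph
        resp x≈ y≈ xy∈ with toWitness xy∈
        ... | f , eq₁ , eq₂ = fromWitness (f , trans eq₁ x≈ , trans eq₂ y≈)

        add : ∀ {x y x′ y′} → Graph (x , y) → Graph (x′ , y′) → Graph (x + x′ , y + y′)
        add (f , eq₁ , eq₂) (g , eq₁′ , eq₂′) = f ⊞ g ,
          trans (E₁.ev-⊞ f g β) (+-cong eq₁ eq₁′) , trans (E₂.ev-⊞ f g β′) (+-cong eq₂ eq₂′)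

        mul : ∀ {x y x′ y′} → Graph (x , y) → Graph (x′ , y′) → Graph (x * x′ , y * y′)
        mul (f , eq₁ , eq₂) (g , eq₁′ , eq₂′) = f ⊠ g ,
          trans (E₁.ev-⊠ f g β) (*-cong eq₁ eq₁′) , trans (E₂.ev-⊠ f g β′) (*-cong eq₂ eq₂′)

        neg : ∀ {x y} → Graph (x , y) → Graph (- x , - y)
        neg (f , eq₁ , eq₂) = scale (R.- R.1#) f ,
          trans (E₁.ev-scale _ f β)  (trans (*-cong (minus-one hom₁) eq₁) (minus _)) ,
          trans (E₂.ev-scale _ f β′) (trans (*-cong (minus-one hom₂) eq₂) (minus _))
          where
          minus-one : ∀ {φ} → RingMorphisms.IsRingHomomorphism R rawRing φ → φ (R.- R.1#) ≈ - 1#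
          minus-one hom = trans (φ.-‿homo _) (-‿cong φ.1#-homo)
            where module φ = RingMorphisms.IsRingHomomorphism hom
          minus : ∀ x → - 1# * x ≈ - x
          minus = solve 1 (λ x → :- con 1ℤ :* x := :- x) refl

        zero⇒zero : ∀ {x y} → Graph (x , y) → x ≈ 0# → y ≈ 0#
        zero⇒zero (f , eq₁ , eq₂) x≈0 = trans (sym eq₂) (transfer mβ′≈0 f (trans eq₁ x≈0))

    adjoin : ∃[ β′ ] ∃[ N ] PartialHom N × (∀ a → (φ₁ a , φ₂ a) ∈ₛ N) × (β , β′) ∈ₛ N
    adjoin with monic-root algebraicallyClosed (Vec.map φ₂ m)
    ... | β′ , mβ′≈0 = β′ , graph mβ′≈0 , graph-partialHom mβ′≈0 , constant∈ mβ′≈0 , X∈ mβ′≈0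

  open Zorn em ext PartialHom

  chainsClosed : ∀ B → ClosedUnderChains B
  chainsClosed _ C (S₀ , S₀∈C) homs chain = record
    { resp   = λ x≈ y≈ xy∈ → let (S , S∈C , xy∈S) = member xy∈ in
                 enlarge S∈C (PartialHom.resp (homs S∈C) x≈ y≈ xy∈S)
    ; scalar = λ k → enlarge S₀∈C (PartialHom.scalar (homs S₀∈C) k)
    ; add    = λ xy∈ x′y′∈ → let (S , S∈C , xy∈S , x′y′∈S) = common xy∈ x′y′∈ in
                 enlarge S∈C (PartialHom.add (homs S∈C) xy∈S x′y′∈S)
    ; mul    = λ xy∈ x′y′∈ → let (S , S∈C , xy∈S , x′y′∈S) = common xy∈ x′y′∈ in
                 enlarge S∈C (PartialHom.mul (homs S∈C) xy∈S x′y′∈S)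
    ; neg    = λ xy∈ → let (S , S∈C , xy∈S) = member xy∈ in
                 enlarge S∈C (PartialHom.neg (homs S∈C) xy∈S)
    ; zero⇒zero = λ xy∈ → let (S , S∈C , xy∈S) = member xy∈ in PartialHom.zero⇒zero (homs S∈C) xy∈S
    }
    where
    enlarge : ∀ {S x} → S ∈ₛ C → x ∈ₛ S → x ∈ₛ ⋃ C
    enlarge {S} {x} S∈C = ⊆-⋃ {C} {S} S∈C {x}

    member : ∀ {x} → x ∈ₛ ⋃ C → ∃[ S ] S ∈ₛ C × x ∈ₛ S
    member {x} = ∈-⋃⁻ {C} {x}

    common : ∀ {x y} → x ∈ₛ ⋃ C → y ∈ₛ ⋃ C → ∃[ S ] S ∈ₛ C × x ∈ₛ S × y ∈ₛ S
    common x∈ y∈ with member x∈ | member y∈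
    ... | S , S∈C , x∈S | S′ , S′∈C , y∈S′ with chain S∈C S′∈C
    ...   | inj₁ S⊆S′ = S′ , S′∈C , S⊆S′ x∈S , y∈S′
    ...   | inj₂ S′⊆S = S , S∈C , x∈S , S′⊆S y∈S′

  -- Adjoining `x` to the domain gives a larger partial homomorphism, which maximality forces back
  -- into `S`.
  maximal⇒total : ∀ {S} → PartialHom S → Maximal S → ∀ x → ∃[ y ] (x , y) ∈ₛ S
  maximal⇒total {S} S-hom maximal x =
    let (y , N , N-hom , S⊆N , xy∈N) = Adjoin.adjoin (partialEmbedding S-hom) x
    in y , maximal {N} N-hom (λ {pq} pq∈S → S⊆N (proj₁ pq , proj₂ pq , pq∈S)) {x , y} xy∈N

  maximal-swapped : ∀ {S} → Maximal S → Maximal (S ∘ swap)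
  maximal-swapped maximal {N} N-hom S⊆N {x} = maximal {N ∘ swap} (swapped N-hom) (λ {y} → S⊆N {swap y}) {swap x}

  extendToAutomorphism : ∀ {B} → PartialHom B → ∃[ σ ] (∀ {x y} → (x , y) ∈ₛ B → Automorphism.⟦_⟧ σ x ≈ y)
  extendToAutomorphism {B} B-hom with zorn B (chainsClosed B) B-hom
  ... | S , B⊆S , S-hom , maximal = σ , λ xy∈B → functional (graph∈ _) (B⊆S xy∈B) refl
    where
    open PartialHom S-hom
    image : ∀ x → ∃[ y ] (x , y) ∈ₛ S
    image = maximal⇒total S-hom maximal

    onto : ∀ y → ∃[ x ] (x , y) ∈ₛ S
    onto = maximal⇒total (swapped S-hom) (λ {N} → maximal-swapped maximal {N})

    f : Carrier → Carrier
    f x = proj₁ (image x)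

    graph∈ : ∀ x → (x , f x) ∈ₛ S
    graph∈ x = proj₂ (image x)

    σ : Automorphism
    σ = record
      { ⟦_⟧ = f
      ; isRingIsomorphism = record
        { isRingMonomorphism = record
          { isRingHomomorphism = ringHomomorphism f
              (functional (graph∈ _) (graph∈ _))
              (λ x y → functional (graph∈ _) (add (graph∈ x) (graph∈ y)) refl)
              (functional (graph∈ _) 0∈ refl)
              (λ x y → functional (graph∈ _) (mul (graph∈ x) (graph∈ y)) refl)
              (functional (graph∈ _) 1∈ refl)
              (λ x → functional (graph∈ _) (neg (graph∈ x)) refl)
          ; injective = PartialHom.functional (swapped S-hom) (graph∈ _) (graph∈ _)
          }
        ; surjective = λ y → proj₁ (onto y) , λ z≈x → functional (graph∈ _) (proj₂ (onto y)) z≈x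
        }
      ; fixes = λ k → functional (graph∈ _) (scalar k) refl
      }

  embed-· : ∀ n → embed (n K.· K.1#) ≈ n · 1#
  embed-· zero    = embed.0#-homo
  embed-· (suc n) = trans (embed.+-homo _ _) (+-cong embed.1#-homo (embed-· n))

  last-map : ∀ {a b} {A : Set a} {B : Set b} (f : A → B) {n} (xs : Vec A (suc n)) →
             Vec.last (Vec.map f xs) ≡ f (Vec.last xs)
  last-map f (x ∷ [])     = ≡.refl
  last-map f (x ∷ y ∷ xs) = last-map f (y ∷ xs)

  -- The polynomial is (X − γ)ᵈ⁺¹, whose coefficient −(d+1)γ lies in K.
  singleRooted⇒∈K : K.CharacteristicZero → ∀ {d γ} (m : Vec K.Carrier (suc d)) →
    (∀ {x} → monic (Vec.map embed m) x ≈ 0# → x ≈ γ) → ∃[ k ] embed k ≈ γ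
  singleRooted⇒∈K char0 {d} {γ} m single with K.#0⇒inverse (char0 d)
  ... | u , du≈1 = K.- Vec.last m K.* u , (begin
    embed (K.- Vec.last m K.* u)            ≈⟨ trans (embed.*-homo _ u) (*-congʳ (embed.-‿homo _)) ⟩
    - embed (Vec.last m) * embed u          ≈⟨ *-congʳ (-‿cong (reflexive (≡.sym (last-map embed m)))) ⟩
    - Vec.last (Vec.map embed m) * embed u  ≈⟨ *-congʳ (-‿cong (last-of-singleRooted algebraicallyClosed (Vec.map embed m) single)) ⟩
    - - (suc d · 1# * γ) * embed u          ≈⟨ solve 3 (λ d γ u → :- (:- (d :* γ)) :* u := (d :* u) :* γ) refl (suc d · 1#) γ (embed u) ⟩
    (suc d · 1# * embed u) * γ              ≈⟨ *-congʳ (*-congʳ (embed-· (suc d))) ⟨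
    (embed (suc d K.· K.1#) * embed u) * γ  ≈⟨ *-congʳ (embed-unit du≈1) ⟩
    1# * γ                                  ≈⟨ *-identityˡ γ ⟩
    γ                                       ∎)

  abstract
    -- Any root of the minimal polynomial of `γ` is the image of `γ` under a K-embedding of K(γ),
    -- which extends to an automorphism; as `γ` is fixed, it is the only root.
    fixed⇒∈K : K.CharacteristicZero → ∀ γ → (∀ σ → Automorphism.⟦_⟧ σ γ ≈ γ) → ∃[ k ] embed k ≈ γ
    fixed⇒∈K char0 γ fixed = singleRooted⇒∈K char0 (Adjoin.m baseEmbedding γ) single
      where
      single : ∀ {x} → monic (Vec.map embed (Adjoin.m baseEmbedding γ)) x ≈ 0# → x ≈ γ
      single mx≈0 =
        let (σ , extends) = extendToAutomorphism (Adjoin.graph-partialHom baseEmbedding γ mx≈0)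
        in trans (sym (extends (Adjoin.X∈ baseEmbedding γ mx≈0))) (fixed σ)

-- n-th power classes

module Powers (em : ∀ {ℓ} → ExcludedMiddle ℓ) {c ℓ₁ ℓ₂} (K : HeytingField c ℓ₁ ℓ₂)
              (n : ℕ) .{{_ : NonZero n}} where
  open FieldTheory K
  open ClassicalField em K
  open CommutativeSemiringExp commutativeSemiring using (^-distrib-*)
  open SetoidReasoning setoid

  infix 4 _~_
  -- With `h` non-zero this is an equivalence on all of K: the cosets of the n-th powers in K*, and
  -- 0 in a class of its own.
  _~_ : Carrier → Carrier → Set _
  x ~ y = ∃[ h ] ¬ h ≈ 0# × x ≈ y * h ^ n

  ~-refl : ∀ {x} → x ~ x
  ~-refl = 1# , 1≉0 , sym (trans (*-congˡ (1^n≈1 n)) (*-identityʳ _))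

  ~-sym : ∀ {x y} → x ~ y → y ~ x
  ~-sym {x} {y} (h , h≉0 , x≈yhⁿ) with invert h≉0
  ... | h′ , hh′≈1 = h′ , unit⇒≉0 (trans (*-comm h′ h) hh′≈1) , (begin
    y                       ≈⟨ *-identityʳ y ⟨
    y * 1#                  ≈⟨ *-congˡ (^-unit n hh′≈1) ⟨
    y * (h ^ n * h′ ^ n)    ≈⟨ *-assoc _ _ _ ⟨
    y * h ^ n * h′ ^ n      ≈⟨ *-congʳ x≈yhⁿ ⟨
    x * h′ ^ n              ∎)

  ~-trans : ∀ {x y z} → x ~ y → y ~ z → x ~ z
  ~-trans {x} {y} {z} (h , h≉0 , x≈yhⁿ) (g , g≉0 , y≈zgⁿ) = g * h , *-≉0 g≉0 h≉0 , (begin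
    x                    ≈⟨ x≈yhⁿ ⟩
    y * h ^ n            ≈⟨ *-congʳ y≈zgⁿ ⟩
    z * g ^ n * h ^ n    ≈⟨ *-assoc _ _ _ ⟩
    z * (g ^ n * h ^ n)  ≈⟨ *-congˡ (^-distrib-* g h n) ⟨
    z * (g * h) ^ n      ∎)

  FinitelyManyClasses : Set _
  FinitelyManyClasses = ∃[ r ] Σ (Fin r → Carrier) λ rep → ∀ x → ∃[ i ] x ~ rep i

module PowerRoots (em : ∀ {ℓ} → ExcludedMiddle ℓ) {c ℓ₁ ℓ₂} (F : HeytingField c ℓ₁ ℓ₂)
                  (closed : FieldTheory.AlgebraicallyClosed F) where
  open FieldTheory F
  open ClassicalField em F
  open IntegerSolver commutativeRing

  monic-zeros : ∀ k x → monic (Vec.replicate k 0#) x ≈ x ^ k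
  monic-zeros zero    x = refl
  monic-zeros (suc k) x = trans (+-identityˡ _) (*-congˡ (monic-zeros k x))

  X^n-a : ∀ a n x → monic (- a ∷ Vec.replicate n 0#) x ≈ x ^ suc n - a
  X^n-a a n x = trans (+-comm _ _) (+-congʳ (*-congˡ (monic-zeros n x)))

  abstract
    nthRoot : ∀ a n → .{{_ : NonZero n}} → ∃[ x ] x ^ n ≈ a
    nthRoot a (suc n) with monic-root closed (- a ∷ Vec.replicate n 0#)
    ... | x , eq = x , RingProperties.x∙y⁻¹≈ε⇒x≈y ring _ _ (trans (sym (X^n-a a n x)) eq)

    rootsOfUnity : ∀ n → .{{_ : NonZero n}} → ∃[ zs ] (∀ {x} → x ^ n ≈ 1# → Any (x ≈_) zs)
    rootsOfUnity (suc n) with monic-roots closed (- 1# ∷ Vec.replicate n 0#)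
    ... | zs , complete = zs , λ {x} xⁿ≈1 →
      complete (trans (X^n-a 1# n x) (trans (+-congʳ xⁿ≈1) (-‿inverseʳ 1#)))

-- Kummer theory

module Kummer (em : ∀ {ℓ} → ExcludedMiddle ℓ) (ext : ∀ {ℓ ℓ′} → Extensionality ℓ ℓ′)
  {c ℓ₁ ℓ₂ c′ ℓ₁′ ℓ₂′} {K : HeytingField c ℓ₁ ℓ₂} (K̄ : AlgebraicClosure K c′ ℓ₁′ ℓ₂′)
  (char0 : FieldTheory.CharacteristicZero K)
  (finitelyGenerated : AbsoluteGalois.TopologicallyFinitelyGenerated K̄)
  (n : ℕ) .{{_ : NonZero n}} where
  private
    module K where
      open FieldTheory K public
      open ClassicalField em K public
      open CommutativeSemiringExp commutativeSemiring using (^-congˡ) public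
  open AlgebraicClosure K̄
  open ClassicalField em heytingField
  open PowerRoots em heytingField algebraicallyClosed
  open AbsoluteGalois K̄
  open Automorphism using (⟦_⟧)
  open Membership (Group.setoid galoisGroup) using () renaming (_∈_ to _∈ᴬ_)
  open GaloisTheory em ext K̄ using (embed-≉0; embed-injective; fixed⇒∈K)
  open Powers em K n using (_~_; FinitelyManyClasses)
  open CommutativeSemiringExp commutativeSemiring using (^-distrib-*; ^-congˡ)
  open SetoidReasoning setoid
  open IntegerSolver commutativeRing
  private module embed = RingMorphisms.IsRingHomomorphism isRingHomomorphism

  embed-^ : ∀ x m → embed (x K.^ m) ≈ embed x ^ m
  embed-^ x zero    = embed.1#-homo
  embed-^ x (suc m) = trans (embed.*-homo _ _) (*-congˡ (embed-^ x m))

  automorphism-^ : ∀ σ x m → ⟦ σ ⟧ (x ^ m) ≈ ⟦ σ ⟧ x ^ m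
  automorphism-^ σ x zero    = Automorphism.1#-homo σ
  automorphism-^ σ x (suc m) = trans (Automorphism.*-homo σ _ _) (*-congˡ (automorphism-^ σ x m))

  automorphism-unit : ∀ σ {x y} → x * y ≈ 1# → ⟦ σ ⟧ x * ⟦ σ ⟧ y ≈ 1#
  automorphism-unit σ xy≈1 = trans (sym (Automorphism.*-homo σ _ _))
    (trans (Automorphism.⟦⟧-cong σ xy≈1) (Automorphism.1#-homo σ))

  generators : List Automorphism
  generators = proj₁ finitelyGenerated

  -- The stabiliser of `γ` is a subgroup, so it contains all that the generators generate; density,
  -- tested on `γ` alone, gives such an element with the same value at `γ` as `σ`.
  fixedByGenerators⇒fixed : ∀ {γ} → (∀ i → ⟦ lookup generators i ⟧ γ ≈ γ) → ∀ σ → ⟦ σ ⟧ γ ≈ γ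
  fixedByGenerators⇒fixed {γ} fixed σ with proj₂ finitelyGenerated σ (γ ∷ [])
  ... | τ , generated , τγ≈σγ ∷ [] = trans (sym τγ≈σγ) (fixedBy generated)
    where
    fixedBy : ∀ {τ} → GeneratedSubgroup galoisGroup (_∈ᴬ generators) τ → ⟦ τ ⟧ γ ≈ γ
    fixedBy (generator τ∈) = trans (Anyₚ.lookup-index τ∈ γ) (fixed (Any.index τ∈))
    fixedBy identity       = refl
    fixedBy (product {σ} {τ} gσ gτ) = trans (Automorphism.⟦⟧-cong σ (fixedBy gτ)) (fixedBy gσ)
    fixedBy (inverse {σ} gσ) = Automorphism.injective σ
      (trans (Automorphism.inverseʳ σ γ) (sym (fixedBy gσ)))
    fixedBy (respects σ≈τ gσ) = trans (sym (σ≈τ γ)) (fixedBy gσ)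

  record Root (x : K.Carrier) : Set (c′ ⊔ ℓ₁′) where
    field
      α α⁻¹   : Carrier
      α^n≈x   : α ^ n ≈ embed x
      α*α⁻¹≈1 : α * α⁻¹ ≈ 1#

  abstract
    root : ∀ {x} → ¬ x K.≈ K.0# → Root x
    root {x} x≉0 with nthRoot (embed x) n
    ... | α , αⁿ≈x with invert {α} (λ α≈0 → embed-≉0 x≉0 (trans (sym αⁿ≈x) (trans (^-congˡ n α≈0) (0^n≈0 n))))
    ...   | α⁻¹ , αα⁻¹≈1 = record { α = α ; α⁻¹ = α⁻¹ ; α^n≈x = αⁿ≈x ; α*α⁻¹≈1 = αα⁻¹≈1 }

  module _ {x} (a : Root x) where
    open Root a

    -- The Kummer cocycle σ ↦ σ(α)/α ∈ μₙ.
    cocycle : Automorphism → Carrier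
    cocycle σ = ⟦ σ ⟧ α * α⁻¹

    cocycle-spec : ∀ σ → ⟦ σ ⟧ α ≈ cocycle σ * α
    cocycle-spec σ = begin
      ⟦ σ ⟧ α               ≈⟨ *-identityʳ _ ⟨
      ⟦ σ ⟧ α * 1#          ≈⟨ *-congˡ α*α⁻¹≈1 ⟨
      ⟦ σ ⟧ α * (α * α⁻¹)   ≈⟨ solve 3 (λ s a b → s :* (a :* b) := s :* b :* a) refl (⟦ σ ⟧ α) α α⁻¹ ⟩
      ⟦ σ ⟧ α * α⁻¹ * α     ∎

    cocycle-rootOfUnity : ∀ σ → cocycle σ ^ n ≈ 1#
    cocycle-rootOfUnity σ = begin
      (⟦ σ ⟧ α * α⁻¹) ^ n      ≈⟨ ^-distrib-* _ _ n ⟩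
      ⟦ σ ⟧ α ^ n * α⁻¹ ^ n    ≈⟨ *-congʳ (automorphism-^ σ α n) ⟨
      ⟦ σ ⟧ (α ^ n) * α⁻¹ ^ n  ≈⟨ *-congʳ (Automorphism.⟦⟧-cong σ α^n≈x) ⟩
      ⟦ σ ⟧ (embed x) * α⁻¹ ^ n ≈⟨ *-congʳ (Automorphism.fixes σ x) ⟩
      embed x * α⁻¹ ^ n        ≈⟨ *-congʳ α^n≈x ⟨
      α ^ n * α⁻¹ ^ n          ≈⟨ ^-unit n α*α⁻¹≈1 ⟩
      1#                       ∎

  module _ {x y} (x≉0 : ¬ x K.≈ K.0#) (a : Root x) (b : Root y) where
    private
      module a = Root a
      module b = Root b

    γ : Carrier
    γ = a.α * b.α⁻¹

    -- `σ` multiplies both roots by the same root of unity, which cancels in their quotient. The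
    -- computation is done after multiplication by the non-zero image of `b.α`.
    sameCocycle⇒fixed : ∀ σ → cocycle a σ ≈ cocycle b σ → ⟦ σ ⟧ γ ≈ γ
    sameCocycle⇒fixed σ same = *-cancelˡ-≈ (unit⇒≉0 (automorphism-unit σ b.α*α⁻¹≈1)) (begin
      ⟦ σ ⟧ b.α * ⟦ σ ⟧ γ                     ≈⟨ *-congˡ (Automorphism.*-homo σ _ _) ⟩
      ⟦ σ ⟧ b.α * (⟦ σ ⟧ a.α * ⟦ σ ⟧ b.α⁻¹)
        ≈⟨ solve 3 (λ b a b′ → b :* (a :* b′) := (b :* b′) :* a) refl (⟦ σ ⟧ b.α) (⟦ σ ⟧ a.α) (⟦ σ ⟧ b.α⁻¹) ⟩
      (⟦ σ ⟧ b.α * ⟦ σ ⟧ b.α⁻¹) * ⟦ σ ⟧ a.α   ≈⟨ *-congʳ (automorphism-unit σ b.α*α⁻¹≈1) ⟩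
      1# * ⟦ σ ⟧ a.α                          ≈⟨ *-congˡ (trans (cocycle-spec a σ) (*-congʳ same)) ⟩
      1# * (cocycle b σ * a.α)                ≈⟨ *-congʳ b.α*α⁻¹≈1 ⟨
      (b.α * b.α⁻¹) * (cocycle b σ * a.α)
        ≈⟨ solve 4 (λ b b′ c a → (b :* b′) :* (c :* a) := (c :* b) :* (a :* b′)) refl b.α b.α⁻¹ (cocycle b σ) a.α ⟩
      (cocycle b σ * b.α) * γ                 ≈⟨ *-congʳ (cocycle-spec b σ) ⟨
      ⟦ σ ⟧ b.α * γ                           ∎)

    γ∈K⇒~ : ∃[ h ] embed h ≈ γ → x ~ y
    γ∈K⇒~ (h , h≈γ) = h , h≉0 , x≈yhⁿ
      where
      x≈yhⁿ : x K.≈ y K.* h K.^ n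
      x≈yhⁿ = embed-injective (begin
        embed x                              ≈⟨ a.α^n≈x ⟨
        a.α ^ n                              ≈⟨ *-identityˡ _ ⟨
        1# * a.α ^ n                         ≈⟨ *-congʳ (^-unit n b.α*α⁻¹≈1) ⟨
        (b.α ^ n * b.α⁻¹ ^ n) * a.α ^ n
          ≈⟨ solve 3 (λ b b′ a → (b :* b′) :* a := b :* (a :* b′)) refl (b.α ^ n) (b.α⁻¹ ^ n) (a.α ^ n) ⟩
        b.α ^ n * (a.α ^ n * b.α⁻¹ ^ n)      ≈⟨ *-congˡ (^-distrib-* a.α b.α⁻¹ n) ⟨
        b.α ^ n * γ ^ n                      ≈⟨ *-cong (sym b.α^n≈x) (^-congˡ n h≈γ) ⟨
        embed y * embed h ^ n                ≈⟨ *-congˡ (embed-^ h n) ⟨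
        embed y * embed (h K.^ n)            ≈⟨ embed.*-homo _ _ ⟨
        embed (y K.* h K.^ n)                ∎)

      h≉0 : ¬ h K.≈ K.0#
      h≉0 h≈0 = x≉0 (K.trans x≈yhⁿ (K.trans (K.*-congˡ (K.trans (K.^-congˡ n h≈0) (K.0^n≈0 n))) (K.zeroʳ y)))

    sameCocycle⇒~ : (∀ i → cocycle a (lookup generators i) ≈ cocycle b (lookup generators i)) → x ~ y
    sameCocycle⇒~ same =
      γ∈K⇒~ (fixed⇒∈K char0 γ (fixedByGenerators⇒fixed (λ i → sameCocycle⇒fixed (lookup generators i) (same i))))

  finitelyManyClasses : FinitelyManyClasses
  -- The extra class is that of 0, which has no cocycle.
  finitelyManyClasses = suc N , rep , covered
    where
    zs : List Carrier
    zs = proj₁ (rootsOfUnity n)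

    complete : ∀ {x} → x ^ n ≈ 1# → Any (x ≈_) zs
    complete = proj₂ (rootsOfUnity n)

    N : ℕ
    N = length zs ℕ.^ length generators

    position : ∀ {x} (x≉0 : ¬ x K.≈ K.0#) i → Any (cocycle (root x≉0) (lookup generators i) ≈_) zs
    position x≉0 i = complete (cocycle-rootOfUnity (root x≉0) (lookup generators i))

    class : ∀ {x} → ¬ x K.≈ K.0# → Fin N
    class x≉0 = funToFin (λ i → Any.index (position x≉0 i))

    class-≡ : ∀ {x y} (x≉0 : ¬ x K.≈ K.0#) (y≉0 : ¬ y K.≈ K.0#) → class x≉0 ≡ class y≉0 → x ~ y
    class-≡ x≉0 y≉0 eq = sameCocycle⇒~ x≉0 (root x≉0) (root y≉0) λ i →
      trans (Anyₚ.lookup-index (position x≉0 i))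
        (trans (reflexive (≡.cong (lookup zs) (funToFin-injective {length generators} eq i)))
               (sym (Anyₚ.lookup-index (position y≉0 i))))

    Inhabited : Fin N → Set _
    Inhabited k = ∃[ x ] Σ (¬ x K.≈ K.0#) λ x≉0 → class x≉0 ≡ k

    rep : Fin (suc N) → K.Carrier
    rep zero    = K.0#
    rep (suc k) with em {P = Inhabited k}
    ... | yes (x , _) = x
    -- No element has this code, so the value is arbitrary.
    ... | no  _       = K.0#

    ~-rep : ∀ {x} (x≉0 : ¬ x K.≈ K.0#) → x ~ rep (suc (class x≉0))
    ~-rep x≉0 with em {P = Inhabited (class x≉0)}
    ... | yes (y , y≉0 , eq) = class-≡ x≉0 y≉0 (≡.sym eq)
    ... | no  none           = ⊥-elim (none (_ , x≉0 , ≡.refl))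

    covered : ∀ x → ∃[ k ] x ~ rep k
    covered x with em {P = x K.≈ K.0#}
    ... | no  x≉0 = suc (class x≉0) , ~-rep x≉0
    ... | yes x≈0 = zero , K.1# , K.1≉0 , K.trans x≈0 (K.sym (K.zeroˡ _))

-- Points on the curve

bit : ∀ {p} {P : Set p} → Dec P → Fin 2
bit (yes _) = zero
bit (no _)  = suc zero

bit-cong : ∀ {p q} {P : Set p} {Q : Set q} (P? : Dec P) (Q? : Dec Q) → (P → Q) → (Q → P) → bit P? ≡ bit Q?
bit-cong (yes _) (yes _) _   _   = ≡.refl
bit-cong (yes p) (no ¬q) P⇒Q _   = ⊥-elim (¬q (P⇒Q p))
bit-cong (no ¬p) (yes q) _   Q⇒P = ⊥-elim (¬p (Q⇒P q))
bit-cong (no _)  (no _)  _   _   = ≡.refl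

bit-transfer : ∀ {p q} {P : Set p} {Q : Set q} (P? : Dec P) (Q? : Dec Q) → bit P? ≡ bit Q? → P → Q
bit-transfer _       (yes q) _  _ = q
bit-transfer (yes _) (no _)  () _
bit-transfer (no ¬p) (no _)  _  p = ⊥-elim (¬p p)

module FermatCurve (em : ∀ {ℓ} → ExcludedMiddle ℓ) {k ℓ₁ ℓ₂} (K : HeytingField k ℓ₁ ℓ₂)
  (char0 : FieldTheory.CharacteristicZero K) (n : ℕ) .{{_ : NonZero n}}
  (finitelyManyClasses : Powers.FinitelyManyClasses em K n) where
  open FieldTheory K
  open ClassicalField em K
  open Powers em K n
  open Gallai +-commutativeMonoid
  open CommutativeSemiringExp commutativeSemiring using (^-distrib-*; ^-congˡ)
  open SemiringMult semiring using (×-assoc-*; ×-congʳ)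
  open RingProperties ring using (+-cancelˡ; -‿involutive; -0#≈0#)
  open SetoidReasoning setoid
  open IntegerSolver commutativeRing

  classes : ℕ
  classes = proj₁ finitelyManyClasses

  rep : Fin classes → Carrier
  rep = proj₁ (proj₂ finitelyManyClasses)

  covered : ∀ x → ∃[ i ] x ~ rep i
  covered = proj₂ (proj₂ finitelyManyClasses)

  ~-resp : ∀ {x x′ y} → x ≈ x′ → x ~ y → x′ ~ y
  ~-resp x≈x′ (h , h≉0 , eq) = h , h≉0 , trans (sym x≈x′) eq

  -- The set of classes containing x rather than the first index found: this respects _≈_.
  classBit : Carrier → Fin classes → Fin 2
  classBit x i = bit (em {P = x ~ rep i})

  colouring : Colouring (2 ℕ.^ classes)
  colouring = (λ x → funToFin (classBit x)) ,
    (λ x≈y → funToFin-cong {classes} (λ i → bit-cong em em (~-resp x≈y) (~-resp (sym x≈y))))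

  sameColour⇒~ : ∀ {x y} → proj₁ colouring x ≡ proj₁ colouring y → x ~ y
  sameColour⇒~ {x} {y} eq with covered x
  ... | i , x~repᵢ = ~-trans x~repᵢ (~-sym (bit-transfer em em (funToFin-injective {classes} eq i) x~repᵢ))

  ·-≉0 : ∀ {m} → 0 < m → ¬ m · 1# ≈ 0#
  ·-≉0 {suc m} _ = #⇒≉ (char0 m)

  ·-injective : ∀ i j → i · 1# ≈ j · 1# → i ≡ j
  ·-injective zero    zero    _  = ≡.refl
  ·-injective zero    (suc j) eq = ⊥-elim (#⇒≉ (char0 j) (sym eq))
  ·-injective (suc i) zero    eq = ⊥-elim (#⇒≉ (char0 i) eq)
  ·-injective (suc i) (suc j) eq = ≡.cong suc (·-injective i j (+-cancelˡ _ _ _ eq))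

  abstract
    -- Adding 0 to the vectors gives the base point `u` the common colour, so every term can be
    -- compared with `u`.
    progression : ∀ ws → ∃[ u ] ∃[ t ] ¬ t ≈ 0# × All (λ w → u + t * w ~ u) ws
    progression ws with gallai 0# ws colouring
    ... | (u , m) , 0<m , κ , eq₀ ∷ eqs = u , m · 1# , ·-≉0 0<m , All.map (λ {w} → related w) eqs
      where
      at≈ : ∀ w → at (u , m) w ≈ u + m · 1# * w
      at≈ w = +-congˡ (sym (trans (×-assoc-* m 1# w) (×-congʳ m (*-identityˡ w))))

      at-0 : at (u , m) 0# ≈ u
      at-0 = trans (at≈ 0#) (trans (+-congˡ (zeroʳ _)) (+-identityʳ u))

      related : ∀ w → proj₁ colouring (at (u , m) w) ≡ κ → u + m · 1# * w ~ u
      related w eq = ~-trans (~-resp (at≈ w) (sameColour⇒~ (≡.trans eq (≡.sym eq₀)))) (~-resp (sym at-0) ~-refl)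

  -- Only 0 is in the class of 0, so u = 0 would make tw vanish.
  progression-≉0 : ∀ {u t w} → ¬ t ≈ 0# → ¬ w ≈ 0# → u + t * w ~ u → ¬ u ≈ 0#
  progression-≉0 {u} {t} {w} t≉0 w≉0 (h , _ , eq) u≈0 = *-≉0 t≉0 w≉0 (begin
    t * w         ≈⟨ +-identityˡ _ ⟨
    0# + t * w    ≈⟨ +-congʳ u≈0 ⟨
    u + t * w     ≈⟨ eq ⟩
    u * h ^ n     ≈⟨ *-congʳ u≈0 ⟩
    0# * h ^ n    ≈⟨ zeroˡ _ ⟩
    0#            ∎)

  -- Multiplying by t turns p = (u/t)g into ug, so u can be cancelled from the whole equation.
  quotientSolution : ∀ {r u t t⁻¹ p h g} → ¬ u ≈ 0# → t * t⁻¹ ≈ 1# → p ≈ u * t⁻¹ * g →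
    u + t * (r * p) ≈ u * h → h ≈ 1# + r * g
  quotientSolution {r} {u} {t} {t⁻¹} {p} {h} {g} u≉0 tt⁻¹≈1 p≈ eq = *-cancelˡ-≈ u≉0 (begin
    u * h                         ≈⟨ eq ⟨
    u + t * (r * p)               ≈⟨ +-congˡ (*-congˡ (*-congˡ p≈)) ⟩
    u + t * (r * (u * t⁻¹ * g))
      ≈⟨ solve 5 (λ u t r t′ g → u :+ t :* (r :* (u :* t′ :* g)) := u :+ (t :* t′) :* (u :* (r :* g))) refl u t r t⁻¹ g ⟩
    u + (t * t⁻¹) * (u * (r * g)) ≈⟨ +-congˡ (*-congʳ tt⁻¹≈1) ⟩
    u + 1# * (u * (r * g))        ≈⟨ solve 2 (λ u x → u :+ con 1ℤ :* (u :* x) := u :* (con 1ℤ :+ x)) refl u (r * g) ⟩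
    u * (1# + r * g)              ∎)

  Difference : Carrier → Set _
  Difference r = ∃[ h ] ∃[ g ] ¬ h ≈ 0# × ¬ g ≈ 0# × h ^ n ≈ 1# + r * g ^ n

  -- Some multiple g t of the step t by a class representative g lies in the class of u,
  -- so including r g among the vectors makes the difference of two terms r times a third.
  progression⇒difference : ∀ {r} → ¬ r ≈ 0# →
    ∃[ u ] ∃[ t ] ¬ t ≈ 0# × All (λ w → u + t * w ~ u) (r ∷ tabulate (λ i → r * rep i)) → Difference r
  progression⇒difference {r} r≉0 (u , t , t≉0 , u+tr~u ∷ u+trg~u) = conclude (invert t≉0)
    where
    conclude : ∃[ t⁻¹ ] t * t⁻¹ ≈ 1# → Difference r
    conclude (t⁻¹ , tt⁻¹≈1) = finish (covered (u * t⁻¹))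
      where
      finish : ∃[ i ] u * t⁻¹ ~ rep i → Difference r
      finish (i , ut⁻¹~rep) with ~-sym ut⁻¹~rep | Allₚ.tabulate⁻ u+trg~u i
      ... | g , g≉0 , eqᵍ | h , h≉0 , eqʰ =
        h , g , h≉0 , g≉0 , quotientSolution (progression-≉0 t≉0 r≉0 u+tr~u) tt⁻¹≈1 eqᵍ eqʰ

  abstract
    difference : ∀ {r} → ¬ r ≈ 0# → Difference r
    difference r≉0 = progression⇒difference r≉0 (progression _)

  -‿≉0 : ∀ {x} → ¬ x ≈ 0# → ¬ - x ≈ 0#
  -‿≉0 {x} x≉0 -x≈0 = x≉0 (trans (sym (-‿involutive x)) (trans (-‿cong -x≈0) -0#≈0#))

  cancelSolution : ∀ {P Q c P⁻¹ p q} → P + Q ≈ 0# → P * P⁻¹ ≈ 1# →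
    p ≈ 1# + - c * P⁻¹ * q → P * p + Q + c * q ≈ 0#
  cancelSolution {P} {Q} {c} {P⁻¹} {p} {q} P+Q≈0 PP⁻¹≈1 eq = begin
      P * p + Q + c * q                       ≈⟨ +-congʳ (+-congʳ (*-congˡ eq)) ⟩
      P * (1# + - c * P⁻¹ * q) + Q + c * q
        ≈⟨ solve 5 (λ P Q c P′ q → P :* (con 1ℤ :+ :- c :* P′ :* q) :+ Q :+ c :* q := (P :+ Q) :+ c :* q :* (con 1ℤ :- P :* P′))
             refl P Q c P⁻¹ q ⟩
      (P + Q) + c * q * (1# - P * P⁻¹)        ≈⟨ +-cong P+Q≈0 (*-congˡ (+-congˡ (-‿cong PP⁻¹≈1))) ⟩
      0# + c * q * (1# - 1#)                  ≈⟨ solve 1 (λ x → con 0ℤ :+ x :* (con 1ℤ :- con 1ℤ) := con 0ℤ) refl (c * q) ⟩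
      0#                                      ∎

  -- As Q = -P, division by P leaves hⁿ = 1 - (c/P)gⁿ, which is `difference` for r = -c/P.
  fillZero : ∀ {P Q c} → ¬ P ≈ 0# → ¬ c ≈ 0# → P + Q ≈ 0# →
             ∃[ h ] ∃[ g ] ¬ h ≈ 0# × ¬ g ≈ 0# × P * h ^ n + Q + c * g ^ n ≈ 0#
  fillZero {P} {Q} {c} P≉0 c≉0 P+Q≈0 =
    let (P⁻¹ , PP⁻¹≈1) = invert P≉0
        (h , g , h≉0 , g≉0 , eq) = difference (*-≉0 (-‿≉0 c≉0) (unit⇒≉0 (trans (*-comm P⁻¹ P) PP⁻¹≈1)))
    in h , g , h≉0 , g≉0 , cancelSolution P+Q≈0 PP⁻¹≈1 eq

  -- After multiplication by u the terms A·tmB and B·tm(-A) cancel, leaving u(A + B + C).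
  scaledSolution : ∀ {A B C u t m p q} → ¬ u ≈ 0# → A + B + C ≈ 0# →
    u + t * (m * B) ≈ u * p → u + t * (m * - A) ≈ u * q → A * p + B * q + C ≈ 0#
  scaledSolution {A} {B} {C} {u} {t} {m} {p} {q} u≉0 A+B+C≈0 eqᵖ eqᑫ = x*y≈0⇒y≈0 u≉0 (begin
    u * (A * p + B * q + C)
      ≈⟨ solve 6 (λ u A B C p q → u :* (A :* p :+ B :* q :+ C) := A :* (u :* p) :+ B :* (u :* q) :+ u :* C)
           refl u A B C p q ⟩
    A * (u * p) + B * (u * q) + u * C
      ≈⟨ +-congʳ (+-cong (*-congˡ eqᵖ) (*-congˡ eqᑫ)) ⟨
    A * (u + t * (m * B)) + B * (u + t * (m * - A)) + u * C
      ≈⟨ solve 6 (λ u A B C t m → A :* (u :+ t :* (m :* B)) :+ B :* (u :+ t :* (m :* :- A)) :+ u :* C := u :* (A :+ B :+ C))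
           refl u A B C t m ⟩
    u * (A + B + C)             ≈⟨ *-congˡ A+B+C≈0 ⟩
    u * 0#                      ≈⟨ zeroʳ u ⟩
    0#                          ∎)

  step-injective : ∀ {u t B p q} → ¬ t ≈ 0# → ¬ B ≈ 0# → u + t * (p * B) ≈ u + t * (q * B) → p ≈ q
  step-injective {u} {t} {B} {p} {q} t≉0 B≉0 eq = *-cancelˡ-≈ (*-≉0 t≉0 B≉0)
    (trans (rearrange p) (trans (+-cancelˡ u _ _ eq) (sym (rearrange q))))
    where
    rearrange : ∀ m → t * B * m ≈ t * (m * B)
    rearrange m = solve 3 (λ t B m → t :* B :* m := t :* (m :* B)) refl t B m

  Scalings : Carrier → Carrier → Carrier → ℕ → Set _
  Scalings A B C N = Σ (Fin N → Carrier) λ β → Σ (Fin N → Carrier) λ γ →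
    (∀ i → A * β i ^ n + B * γ i ^ n + C ≈ 0#) × (∀ i j → β i ≈ β j → i ≡ j)

  module _ {A B C : Carrier} (A≉0 : ¬ A ≈ 0#) (B≉0 : ¬ B ≈ 0#) (A+B+C≈0 : A + B + C ≈ 0#) (N : ℕ) where

    factor : Fin N → Carrier
    -- Starting at 1 makes every vector non-zero, as `progression-≉0` demands.
    factor i = suc (toℕ i) · 1#

    steps : List Carrier
    steps = tabulate (λ i → factor i * B) ++ tabulate (λ i → factor i * - A)

    scalings : ∃[ u ] ∃[ t ] ¬ t ≈ 0# × All (λ w → u + t * w ~ u) steps → Scalings A B C N
    scalings (u , t , t≉0 , related) = (λ i → proj₁ (betas i)) , (λ i → proj₁ (gammas i)) , solves , distinct
      where
      betas : ∀ i → u + t * (factor i * B) ~ u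
      betas = Allₚ.tabulate⁻ (Allₚ.++⁻ˡ (tabulate (λ i → factor i * B)) related)

      gammas : ∀ i → u + t * (factor i * - A) ~ u
      gammas = Allₚ.tabulate⁻ (Allₚ.++⁻ʳ (tabulate (λ i → factor i * B)) related)

      solves : ∀ i → A * proj₁ (betas i) ^ n + B * proj₁ (gammas i) ^ n + C ≈ 0#
      solves i with betas i | gammas i
      ... | b@(_ , _ , eqᵇ) | _ , _ , eqᶜ =
        scaledSolution (progression-≉0 t≉0 (*-≉0 (#⇒≉ (char0 (toℕ i))) B≉0) b) A+B+C≈0 eqᵇ eqᶜ

      distinct : ∀ i j → proj₁ (betas i) ≈ proj₁ (betas j) → i ≡ j
      distinct i j eq with betas i | betas j
      ... | _ , _ , eqᵢ | _ , _ , eqⱼ =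
        -- Equal β give equal terms u·βⁿ of the progression, hence equal factors, and characteristic
        -- zero recovers the index.
        Finₚ.toℕ-injective (ℕₚ.suc-injective (·-injective (suc (toℕ i)) (suc (toℕ j))
          (step-injective t≉0 B≉0 (trans eqᵢ (trans (*-congˡ (^-congˡ n eq)) (sym eqⱼ))))))

    abstract
      manyScalings : Scalings A B C N
      manyScalings = scalings (progression steps)

  Solution : Carrier → Carrier → Carrier → Carrier → Carrier → Carrier → Set _
  Solution a b c x y z = a * x ^ n + b * y ^ n + c * z ^ n ≈ 0#

  SolutionWithoutZeros : Carrier → Carrier → Carrier → Set _
  SolutionWithoutZeros a b c = ∃[ x ] ∃[ y ] ∃[ z ] ¬ x ≈ 0# × ¬ y ≈ 0# × ¬ z ≈ 0# × Solution a b c x y z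

  monomial-zero : ∀ a {x} → x ≈ 0# → a * x ^ n ≈ 0#
  monomial-zero a x≈0 = trans (*-congˡ (trans (^-congˡ n x≈0) (0^n≈0 n))) (zeroʳ a)

  scaled : ∀ a x h → a * (x * h) ^ n ≈ a * x ^ n * h ^ n
  scaled a x h = trans (*-congˡ (^-distrib-* x h n)) (sym (*-assoc _ _ _))

  -- The first two terms already sum to zero; `fillZero` rescales x and puts a non-zero value in
  -- place of z.
  oneZero : ∀ {a b c x y z} → ¬ a ≈ 0# → ¬ c ≈ 0# → ¬ x ≈ 0# → ¬ y ≈ 0# → z ≈ 0# →
            Solution a b c x y z → SolutionWithoutZeros a b c
  oneZero {a} {b} {c} {x} {y} {z} a≉0 c≉0 x≉0 y≉0 z≈0 eq =
    let (h , g , h≉0 , g≉0 , eq′) = fillZero (*-≉0 a≉0 (^-≉0 n x≉0)) c≉0 twoTerms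
    in x * h , y , g , *-≉0 x≉0 h≉0 , y≉0 , g≉0 , trans (+-congʳ (+-congʳ (scaled a x h))) eq′
    where
    twoTerms : a * x ^ n + b * y ^ n ≈ 0#
    twoTerms = trans (sym (trans (+-congˡ (monomial-zero c z≈0)) (+-identityʳ _))) eq

  twoZeros : ∀ {a b c x y z} → ¬ a ≈ 0# → ¬ x ≈ 0# → y ≈ 0# → z ≈ 0# → ¬ Solution a b c x y z
  twoZeros {a} {b} {c} {x} {y} {z} a≉0 x≉0 y≈0 z≈0 eq = *-≉0 a≉0 (^-≉0 n x≉0) (begin
    a * x ^ n                           ≈⟨ trans (+-identityʳ _) (+-identityʳ _) ⟨
    a * x ^ n + 0# + 0#                 ≈⟨ +-cong (+-congˡ (monomial-zero b y≈0)) (monomial-zero c z≈0) ⟨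
    a * x ^ n + b * y ^ n + c * z ^ n   ≈⟨ eq ⟩
    0#                                  ∎)

  -- Cyclic symmetry reduces all positions of the vanishing coordinates to the trailing ones.
  rotate : ∀ {a b c x y z} → Solution a b c x y z → Solution b c a y z x
  rotate eq = trans (trans (+-comm _ _) (sym (+-assoc _ _ _))) eq

  rotateWithoutZeros : ∀ {a b c} → SolutionWithoutZeros a b c → SolutionWithoutZeros b c a
  rotateWithoutZeros (x , y , z , x≉0 , y≉0 , z≉0 , eq) = y , z , x , y≉0 , z≉0 , x≉0 , rotate eq

  withoutZeros : ∀ {a b c x y z} → ¬ a ≈ 0# → ¬ b ≈ 0# → ¬ c ≈ 0# →
    ¬ (x ≈ 0# × y ≈ 0# × z ≈ 0#) → Solution a b c x y z → SolutionWithoutZeros a b c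
  withoutZeros {a} {b} {c} {x} {y} {z} a≉0 b≉0 c≉0 nonTrivial eq = cases em em em
    where
    cases : Dec (x ≈ 0#) → Dec (y ≈ 0#) → Dec (z ≈ 0#) → SolutionWithoutZeros a b c
    cases (no x≉0)  (no y≉0)  (no z≉0)  = x , y , z , x≉0 , y≉0 , z≉0 , eq
    cases (no x≉0)  (no y≉0)  (yes z≈0) = oneZero a≉0 c≉0 x≉0 y≉0 z≈0 eq
    cases (yes x≈0) (no y≉0)  (no z≉0)  =
      rotateWithoutZeros (rotateWithoutZeros (oneZero b≉0 a≉0 y≉0 z≉0 x≈0 (rotate eq)))
    cases (no x≉0)  (yes y≈0) (no z≉0)  =
      rotateWithoutZeros (oneZero c≉0 b≉0 z≉0 x≉0 y≈0 (rotate (rotate eq)))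
    cases (no x≉0)  (yes y≈0) (yes z≈0) = ⊥-elim (twoZeros a≉0 x≉0 y≈0 z≈0 eq)
    cases (yes x≈0) (no y≉0)  (yes z≈0) = ⊥-elim (twoZeros b≉0 y≉0 z≈0 x≈0 (rotate eq))
    cases (yes x≈0) (yes y≈0) (no z≉0)  = ⊥-elim (twoZeros c≉0 z≉0 x≈0 y≈0 (rotate (rotate eq)))
    cases (yes x≈0) (yes y≈0) (yes z≈0) = ⊥-elim (nonTrivial (x≈0 , y≈0 , z≈0))

  fromℚ-≉0 : ∀ q → q ≢ 0ℚ → ¬ fromℚ char0 q ≈ 0#
  fromℚ-≉0 q@(mkℚ num den-1 _) q≢0 = *-≉0 (num≉0 num (λ num≡0 → q≢0 (ℚₚ.↥p≡0⇒p≡0 q num≡0)))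
    (unit⇒≉0 (trans (*-comm _ _) (proj₂ (#0⇒inverse (char0 den-1)))))
    where
    num≉0 : ∀ i → i ≢ 0ℤ → ¬ fromℤ i ≈ 0#
    num≉0 (ℤ.+ zero)  i≢0 = ⊥-elim (i≢0 ≡.refl)
    num≉0 (ℤ.+ suc m) i≢0 = #⇒≉ (char0 m)
    num≉0 ℤ.-[1+ m ]  i≢0 -m≈0 = #⇒≉ (char0 m)
      (trans (sym (-‿involutive _)) (trans (-‿cong -m≈0) (-0#≈0#)))

  open ProjectivePlane K

  nonTrivial : (P : HomogeneousCoordinates) → let open HomogeneousCoordinates P in ¬ (x ≈ 0# × y ≈ 0# × z ≈ 0#)
  nonTrivial [ _ ∶ _ ∶ _ ]⟨ inj₁ x#0 ⟩        (x≈0 , _ , _) = #⇒≉ x#0 x≈0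
  nonTrivial [ _ ∶ _ ∶ _ ]⟨ inj₂ (inj₁ y#0) ⟩ (_ , y≈0 , _) = #⇒≉ y#0 y≈0
  nonTrivial [ _ ∶ _ ∶ _ ]⟨ inj₂ (inj₂ z#0) ⟩ (_ , _ , z≈0) = #⇒≉ z#0 z≈0

  module _ (a b c : ℚ) (a≢0 : a ≢ 0ℚ) (b≢0 : b ≢ 0ℚ) (c≢0 : c ≢ 0ℚ) where

    private
      X = fermatCurvePoints char0 a b c n
      A = fromℚ char0 a
      B = fromℚ char0 b
      C = fromℚ char0 c
    open Setoid X using () renaming (Carrier to Point; _≈_ to _≈ₚ_; sym to symₚ; trans to transₚ)

    scaledPoints : ∀ {x y z N} → ¬ x ≈ 0# → ¬ z ≈ 0# →
      Scalings (A * x ^ n) (B * y ^ n) (C * z ^ n) N →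
      Σ (Fin N → Point) λ P → ∀ i j → P i ≈ₚ P j → i ≡ j
    scaledPoints {x} {y} {z} {N} x≉0 z≉0 (β , γ , solves , injective) = point , distinct
      where
      point : Fin N → Point
      point i = [ x * β i ∶ y * γ i ∶ z ]⟨ inj₂ (inj₂ (≉⇒# z≉0)) ⟩ ,
        trans (+-congʳ (+-cong (scaled A x (β i)) (scaled B y (γ i)))) (solves i)

      distinct : ∀ i j → point i ≈ₚ point j → i ≡ j
      distinct i j (w , _ , ex , _ , ez) = injective i j (sym (*-cancelˡ-≈ x≉0 (begin
        x * β j         ≈⟨ ex ⟩
        w * (x * β i)   ≈⟨ *-congʳ w≈1 ⟩
        1# * (x * β i)  ≈⟨ *-identityˡ _ ⟩
        x * β i         ∎)))
        where
        -- All the points share the non-zero last coordinate `z`, so only the scalar 1 can relate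
        -- two of them.
        w≈1 : w ≈ 1#
        w≈1 = *-cancelˡ-≈ z≉0 (trans (*-comm z w) (trans (sym ez) (sym (*-identityʳ z))))

    abstract
      manyPoints : SolutionWithoutZeros A B C → ∀ N → Σ (Fin N → Point) λ P → ∀ i j → P i ≈ₚ P j → i ≡ j
      manyPoints (x , y , z , x≉0 , y≉0 , z≉0 , eq) N = scaledPoints {y = y} x≉0 z≉0
        (manyScalings (*-≉0 (fromℚ-≉0 a a≢0) (^-≉0 n x≉0)) (*-≉0 (fromℚ-≉0 b b≢0) (^-≉0 n y≉0)) eq N)

    infinite : Point → Infinite X
    infinite (P , onCurve) (xs , enumerates) =
      let (points , distinct) = manyPoints
            (withoutZeros (fromℚ-≉0 a a≢0) (fromℚ-≉0 b b≢0) (fromℚ-≉0 c c≢0) (nonTrivial P) onCurve)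
            -- One point more than the supposed enumeration has entries.
            (suc (length xs))
          listed i = enumerates (points i)
          (i , j , i<j , eq) = Finₚ.pigeonhole (ℕₚ.n<1+n (length xs)) (λ i → Any.index (listed i))
          samePoint = transₚ {points i} {lookup xs (Any.index (listed i))} {points j} (Anyₚ.lookup-index (listed i))
            (≡.subst (λ p → lookup xs p ≈ₚ points j) (≡.sym eq)
              (symₚ {points j} {lookup xs (Any.index (listed j))} (Anyₚ.lookup-index (listed j))))
      in Finₚ.<⇒≢ i<j (distinct i j samePoint)

theorem2 : (∀ {ℓ} → ExcludedMiddle ℓ) →
    (∀ {ℓ ℓ′} → Extensionality ℓ ℓ′) →
    ∀ (a b c : ℚ) → a ≢ 0ℚ → b ≢ 0ℚ → c ≢ 0ℚ →
    ∀ (n : ℕ) → .{{_ : NonZero n}} →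
    ∀ {k ℓ₁ ℓ₂ k′ ℓ₁′ ℓ₂′} →
    (K : HeytingField k ℓ₁ ℓ₂) →
    (char0 : FieldTheory.CharacteristicZero K) →
    (K̄ : AlgebraicClosure K k′ ℓ₁′ ℓ₂′) →
    AbsoluteGalois.TopologicallyFinitelyGenerated K̄ →
    Setoid.Carrier (ProjectivePlane.fermatCurvePoints K char0 a b c n) →
    Infinite (ProjectivePlane.fermatCurvePoints K char0 a b c n)
theorem2 em ext a b c a≢0 b≢0 c≢0 n K char0 K̄ finitelyGenerated =
  FermatCurve.infinite em K char0 n (Kummer.finitelyManyClasses em ext K̄ char0 finitelyGenerated n)
    a b c a≢0 b≢0 c≢0
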